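{- Let $\mathrm{Peak}^c_{\mathcal A(0)}(t)=0$ and, for $n\ge1$, let $\mathrm{Peak}^c_{\mathcal A(n)}(t)=\sum t^{\mathrm{peak}(\mathbf a)}$, where the sum is over all Abelian area sequences $\mathbf a$ of size $n$ for which $\Gamma_{\mathbf a}$ is connected. Then $\mathrm{Peak}^c_{\mathcal A(n)}(t)$ is real-rooted for all $n\ge0$.
   Context: Write $[n]=\{1,\dots,n\}$. An area sequence of size $n$ is a sequence $\mathbf a=(a_1,\dots,a_n)$ of nonnegative integers with $a_i<i$ for all $i$ and $a_i\le a_{i-1}+1$ for all $i\ge 2$. Each area sequence $\mathbf a$ defines a graph $\Gamma_{\mathbf a}$ (a unit interval graph) on $[n]$ with edges $\{j,i\}$ for $1\le j<i\le n$ with $i-a_i\le j$. A peak-edge of $\Gamma_{\mathbf a}$ is either an isolated vertex or an edge $\{i,j\}$, $i<j$, such that neither $\{i,j+1\}$ nor $\{i-1,j\}$ is an edge (pairs not contained in $[n]$ are not edges); $\mathrm{peak}(\mathbf a)$ is the number of peak-edges. An area sequence $\mathbf a$ of size $n$ is Abelian if every vertex $i\ne 1,n$ of $\Gamma_{\mathbf a}$ is adjacent to at least one of the vertices $1$ and $n$. A real polynomial is real-rooted if all its zeros are real; the zero polynomial counts as real-rooted. -}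

module Defs where

open import Data.Nat.Base as ℕ using (ℕ; zero; suc)
import Data.Nat.Properties as ℕ
open import Data.Fin.Base as Fin using (Fin; toℕ; fromℕ)
import Data.Fin.Properties as Fin
open import Data.Vec.Base as Vec using (Vec; []; _∷_; lookup)
import Data.Vec.Properties as Vec
open import Data.List.Base as List
  using (List; []; _∷_; map; filter; length; foldr; upTo; allFin;
         cartesianProduct; cartesianProductWith; replicate; _++_)
open import Data.List.Membership.Propositional using (_∈_)
open import Data.List.Membership.Propositional.Properties
  using (∈-cartesianProductWith⁺; ∈-upTo⁺; ∈-filter⁺; ∈-filter⁻)
open import Data.List.Relation.Unary.All as All using (All)
open import Data.List.Relation.Unary.Any using (here)
open import Data.List.Relation.Unary.AllPairs using ([]; _∷_)
open import Data.List.Relation.Unary.Unique.Propositional using (Unique)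
import Data.List.Relation.Unary.Unique.Propositional.Properties as Unique
open import Data.Product.Base using (Σ; ∃; _×_; _,_; proj₁; proj₂)
open import Data.Sum.Base using (_⊎_; inj₁; inj₂)
open import Data.Rational.Base as ℚ using (ℚ; 0ℚ; 1ℚ; ½; 1/_; ∣_∣)
import Data.Rational.Properties as ℚ
open import Data.Rational.Solver using (module +-*-Solver)
open import Function.Base using (_∘_)
open import Relation.Binary.Construct.Closure.ReflexiveTransitive
  using (Star; ε; _◅_; _◅◅_; reverse)
open import Relation.Binary.PropositionalEquality
  using (_≡_; _≢_; refl; sym; trans; cong; subst; subst₂)
open import Relation.Nullary using (¬_; Dec; yes; no; contradiction)
open import Relation.Nullary.Decidable using (_×-dec_; _⊎-dec_; _→-dec_; ¬?; map′)
open import Relation.Unary using (Decidable)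

------------------------------------------------------------------------
-- Real numbers: Cauchy sequences of rationals (the modulus is part of the
-- data), with equality "the difference tends to 0".

Cauchy : (ℕ → ℚ) → Set
Cauchy x = ∀ e → 0ℚ ℚ.< e →
  ∃ λ N → ∀ m n → N ℕ.≤ m → N ℕ.≤ n → ∣ x m ℚ.- x n ∣ ℚ.< e

record ℝ : Set where
  constructor mkℝ
  field
    seq    : ℕ → ℚ
    cauchy : Cauchy seq
open ℝ public

infix 4 _≈_
record _≈_ (x y : ℝ) : Set where
  constructor mk≈
  field
    diff→0 : ∀ e → 0ℚ ℚ.< e →
      ∃ λ N → ∀ n → N ℕ.≤ n → ∣ seq x n ℚ.- seq y n ∣ ℚ.< e
open _≈_ public

halve : ∀ e → 0ℚ ℚ.< e → 0ℚ ℚ.< ½ ℚ.* e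
halve e 0<e = subst (ℚ._< ½ ℚ.* e) (ℚ.*-zeroʳ ½) (ℚ.*-monoʳ-<-pos ½ 0<e)

halves : ∀ e → ½ ℚ.* e ℚ.+ ½ ℚ.* e ≡ e
halves e = trans (sym (ℚ.*-distribʳ-+ e ½ ½)) (ℚ.*-identityˡ e)

bounded : ∀ {x} → Cauchy x →
  Σ ℚ λ B → 0ℚ ℚ.< B × ∃ λ N → ∀ n → N ℕ.≤ n → ∣ x n ∣ ℚ.< B
bounded {x} cx = B , 0<B , N , λ n N≤n →
    (ℚ.≤-<-trans (subst (λ u → ∣ u ∣ ℚ.≤ ∣ x n ℚ.- x N ∣ ℚ.+ ∣ x N ∣) (cancel (x n) (x N))
                   (ℚ.∣p+q∣≤∣p∣+∣q∣ (x n ℚ.- x N) (x N)))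
                 (ℚ.+-monoˡ-< ∣ x N ∣ (proj₂ c n N N≤n ℕ.≤-refl)))
  where
  0<1 : 0ℚ ℚ.< 1ℚ
  0<1 = ℚ.positive⁻¹ 1ℚ
  c = cx 1ℚ 0<1
  N = proj₁ c
  B = 1ℚ ℚ.+ ∣ x N ∣
  0<B : 0ℚ ℚ.< B
  0<B = ℚ.+-mono-<-≤ 0<1 (ℚ.0≤∣p∣ (x N))
  cancel : ∀ p q → (p ℚ.- q) ℚ.+ q ≡ p
  cancel = solve 2 (λ p q → (p :- q) :+ q := p) refl
    where open +-*-Solver

+-cauchy : ∀ {x y} → Cauchy x → Cauchy y → Cauchy (λ n → x n ℚ.+ y n)
+-cauchy {x} {y} cx cy e 0<e = proj₁ a ℕ.⊔ proj₁ b , λ m n p q →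
  ℚ.≤-<-trans
    (subst (λ u → ∣ u ∣ ℚ.≤ ∣ x m ℚ.- x n ∣ ℚ.+ ∣ y m ℚ.- y n ∣)
      (rearrange (x m) (x n) (y m) (y n))
      (ℚ.∣p+q∣≤∣p∣+∣q∣ (x m ℚ.- x n) (y m ℚ.- y n)))
    (subst (_ ℚ.<_) (halves e)
      (ℚ.+-mono-<
        (proj₂ a m n (ℕ.m⊔n≤o⇒m≤o (proj₁ a) _ p) (ℕ.m⊔n≤o⇒m≤o (proj₁ a) _ q))
        (proj₂ b m n (ℕ.m⊔n≤o⇒n≤o (proj₁ a) _ p) (ℕ.m⊔n≤o⇒n≤o (proj₁ a) _ q))))
  where
  a = cx (½ ℚ.* e) (halve e 0<e)
  b = cy (½ ℚ.* e) (halve e 0<e)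
  rearrange : ∀ p q r s → (p ℚ.- q) ℚ.+ (r ℚ.- s) ≡ (p ℚ.+ r) ℚ.- (q ℚ.+ s)
  rearrange = solve 4 (λ p q r s → (p :- q) :+ (r :- s) := (p :+ r) :- (q :+ s)) refl
    where open +-*-Solver

neg-cauchy : ∀ {x} → Cauchy x → Cauchy (λ n → ℚ.- x n)
neg-cauchy {x} cx e 0<e = proj₁ (cx e 0<e) , λ m n p q →
  subst (ℚ._< e)
    (trans (sym (ℚ.∣-p∣≡∣p∣ (x m ℚ.- x n))) (cong ∣_∣ (flip (x m) (x n))))
    (proj₂ (cx e 0<e) m n p q)
  where
  flip : ∀ p q → ℚ.- (p ℚ.- q) ≡ (ℚ.- p) ℚ.- (ℚ.- q)
  flip = solve 2 (λ p q → :- (p :- q) := (:- p) :- (:- q)) refl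
    where open +-*-Solver

*-bound : ∀ {B d} u v → 0ℚ ℚ.< B → ∣ u ∣ ℚ.< B → ∣ v ∣ ℚ.< d → ∣ u ℚ.* v ∣ ℚ.≤ B ℚ.* d
*-bound {B} {d} u v 0<B u<B v<d = begin
  ∣ u ℚ.* v ∣      ≡⟨ ℚ.∣p*q∣≡∣p∣*∣q∣ u v ⟩
  ∣ u ∣ ℚ.* ∣ v ∣  ≤⟨ ℚ.*-monoʳ-≤-nonNeg ∣ v ∣ {{ℚ.nonNegative (ℚ.0≤∣p∣ v)}} (ℚ.<⇒≤ u<B) ⟩
  B ℚ.* ∣ v ∣      ≤⟨ ℚ.*-monoˡ-≤-nonNeg B {{ℚ.nonNegative (ℚ.<⇒≤ 0<B)}} (ℚ.<⇒≤ v<d) ⟩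
  B ℚ.* d          ∎
  where open ℚ.≤-Reasoning

divide : ∀ D e → 0ℚ ℚ.< D → 0ℚ ℚ.< e → Σ ℚ λ d → 0ℚ ℚ.< d × D ℚ.* d ≡ e
divide D e 0<D 0<e = 1/ D ℚ.* e , 0<d , Dd
  where
  instance
    posD : ℚ.Positive D
    posD = ℚ.positive 0<D
    nzD : ℚ.NonZero D
    nzD = ℚ.pos⇒nonZero D
  0<d : 0ℚ ℚ.< 1/ D ℚ.* e
  0<d = subst (ℚ._< 1/ D ℚ.* e) (ℚ.*-zeroʳ (1/ D))
          (ℚ.*-monoʳ-<-pos (1/ D) {{ℚ.1/pos⇒pos D}} 0<e)
  Dd : D ℚ.* (1/ D ℚ.* e) ≡ e
  Dd = trans (sym (ℚ.*-assoc D (1/ D) e))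
      (trans (cong (ℚ._* e) (ℚ.*-inverseʳ D)) (ℚ.*-identityˡ e))

½e<e : ∀ e → 0ℚ ℚ.< e → ½ ℚ.* e ℚ.< e
½e<e e 0<e = subst₂ ℚ._<_ (ℚ.+-identityʳ (½ ℚ.* e)) (halves e)
               (ℚ.+-monoʳ-< (½ ℚ.* e) (halve e 0<e))

*-diff : ∀ {B C d} p q r s → 0ℚ ℚ.< B → 0ℚ ℚ.< C → ∣ p ∣ ℚ.< B → ∣ s ∣ ℚ.< C →
  ∣ p ℚ.- q ∣ ℚ.< d → ∣ r ℚ.- s ∣ ℚ.< d →
  ∣ p ℚ.* r ℚ.- q ℚ.* s ∣ ℚ.≤ (B ℚ.+ C) ℚ.* d
*-diff {B} {C} {d} p q r s 0<B 0<C p<B s<C pq rs = begin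
  ∣ p ℚ.* r ℚ.- q ℚ.* s ∣
    ≡⟨ cong ∣_∣ (rearrange p q r s) ⟨
  ∣ p ℚ.* (r ℚ.- s) ℚ.+ s ℚ.* (p ℚ.- q) ∣
    ≤⟨ ℚ.∣p+q∣≤∣p∣+∣q∣ (p ℚ.* (r ℚ.- s)) (s ℚ.* (p ℚ.- q)) ⟩
  ∣ p ℚ.* (r ℚ.- s) ∣ ℚ.+ ∣ s ℚ.* (p ℚ.- q) ∣
    ≤⟨ ℚ.+-mono-≤ (*-bound p (r ℚ.- s) 0<B p<B rs) (*-bound s (p ℚ.- q) 0<C s<C pq) ⟩
  B ℚ.* d ℚ.+ C ℚ.* d
    ≡⟨ ℚ.*-distribʳ-+ d B C ⟨
  (B ℚ.+ C) ℚ.* d ∎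
  where
  open ℚ.≤-Reasoning
  rearrange : ∀ p q r s →
    p ℚ.* (r ℚ.- s) ℚ.+ s ℚ.* (p ℚ.- q) ≡ p ℚ.* r ℚ.- q ℚ.* s
  rearrange = solve 4 (λ p q r s →
    p :* (r :- s) :+ s :* (p :- q) := p :* r :- q :* s) refl
    where open +-*-Solver

*-cauchy : ∀ {x y} → Cauchy x → Cauchy y → Cauchy (λ n → x n ℚ.* y n)
*-cauchy {x} {y} cx cy e 0<e =
  let B , 0<B , M , x<B = bounded {x} cx
      C , 0<C , N , y<C = bounded {y} cy
      d , 0<d , Dd      = divide (B ℚ.+ C) (½ ℚ.* e) (ℚ.+-mono-< 0<B 0<C) (halve e 0<e)
  in close B C d 0<B 0<C M N x<B y<C Dd (cx d 0<d) (cy d 0<d)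
  where
  close : ∀ B C d → 0ℚ ℚ.< B → 0ℚ ℚ.< C → ∀ M N →
    (∀ n → M ℕ.≤ n → ∣ x n ∣ ℚ.< B) → (∀ n → N ℕ.≤ n → ∣ y n ∣ ℚ.< C) →
    (B ℚ.+ C) ℚ.* d ≡ ½ ℚ.* e →
    (∃ λ N → ∀ m n → N ℕ.≤ m → N ℕ.≤ n → ∣ x m ℚ.- x n ∣ ℚ.< d) →
    (∃ λ N → ∀ m n → N ℕ.≤ m → N ℕ.≤ n → ∣ y m ℚ.- y n ∣ ℚ.< d) →
    ∃ λ N → ∀ m n → N ℕ.≤ m → N ℕ.≤ n → ∣ x m ℚ.* y m ℚ.- x n ℚ.* y n ∣ ℚ.< e
  close B C d 0<B 0<C M N x<B y<C Dd (a , x-close) (b , y-close) = K , λ m n p q →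
    ℚ.≤-<-trans
      (*-diff (x m) (x n) (y m) (y n) 0<B 0<C
        (x<B m (ℕ.≤-trans M≤K p)) (y<C n (ℕ.≤-trans N≤K q))
        (x-close m n (ℕ.≤-trans a≤K p) (ℕ.≤-trans a≤K q))
        (y-close m n (ℕ.≤-trans b≤K p) (ℕ.≤-trans b≤K q)))
      (subst (ℚ._< e) (sym Dd) (½e<e e 0<e))
    where
    K = (M ℕ.⊔ N) ℕ.⊔ (a ℕ.⊔ b)
    M≤K : M ℕ.≤ K
    M≤K = ℕ.≤-trans (ℕ.m≤m⊔n M N) (ℕ.m≤m⊔n (M ℕ.⊔ N) (a ℕ.⊔ b))
    N≤K : N ℕ.≤ K
    N≤K = ℕ.≤-trans (ℕ.m≤n⊔m M N) (ℕ.m≤m⊔n (M ℕ.⊔ N) (a ℕ.⊔ b))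
    a≤K : a ℕ.≤ K
    a≤K = ℕ.≤-trans (ℕ.m≤m⊔n a b) (ℕ.m≤n⊔m (M ℕ.⊔ N) (a ℕ.⊔ b))
    b≤K : b ℕ.≤ K
    b≤K = ℕ.≤-trans (ℕ.m≤n⊔m a b) (ℕ.m≤n⊔m (M ℕ.⊔ N) (a ℕ.⊔ b))

fromℚ : ℚ → ℝ
fromℚ q = mkℝ (λ _ → q) λ e 0<e → 0 , λ _ _ _ _ →
  subst (λ u → ∣ u ∣ ℚ.< e) (sym (ℚ.+-inverseʳ q)) 0<e

0ℝ 1ℝ : ℝ
0ℝ = fromℚ 0ℚ
1ℝ = fromℚ 1ℚ

infixl 6 _+_ _-_
infixl 7 _*_
infix  8 -_

_+_ _*_ : ℝ → ℝ → ℝ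
x + y = mkℝ (λ n → seq x n ℚ.+ seq y n) (+-cauchy {seq x} {seq y} (cauchy x) (cauchy y))
x * y = mkℝ (λ n → seq x n ℚ.* seq y n) (*-cauchy {seq x} {seq y} (cauchy x) (cauchy y))

-_ : ℝ → ℝ
- x = mkℝ (λ n → ℚ.- seq x n) (neg-cauchy {seq x} (cauchy x))

_-_ : ℝ → ℝ → ℝ
x - y = x + (- y)

record ℂ : Set where
  constructor _+i_
  field
    re im : ℝ
open ℂ public

infix 4 _≈ℂ_
_≈ℂ_ : ℂ → ℂ → Set
z ≈ℂ w = re z ≈ re w × im z ≈ im w

ofℝ : ℝ → ℂ
ofℝ x = x +i 0ℝ

infixl 6 _+ℂ_
infixl 7 _*ℂ_
_+ℂ_ _*ℂ_ : ℂ → ℂ → ℂ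
z +ℂ w = (re z + re w) +i (im z + im w)
z *ℂ w = (re z * re w - im z * im w) +i (re z * im w + im z * re w)

------------------------------------------------------------------------
-- Real polynomials: c₀ ∷ c₁ ∷ … ∷ [] stands for c₀ + c₁ t + … .
-- Trailing zero coefficients are allowed.

Poly : Set
Poly = List ℝ

infixl 6 _+ₚ_
_+ₚ_ : Poly → Poly → Poly
[]      +ₚ q       = q
(c ∷ p) +ₚ []      = c ∷ p
(c ∷ p) +ₚ (d ∷ q) = (c + d) ∷ (p +ₚ q)

sumₚ : List Poly → Poly
sumₚ = foldr _+ₚ_ []

t^_ : ℕ → Poly
t^ k = replicate k 0ℝ ++ 1ℝ ∷ []

eval : Poly → ℂ → ℂ
eval []      z = ofℝ 0ℝ
eval (c ∷ p) z = ofℝ c +ℂ z *ℂ eval p z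

IsZero : Poly → Set
IsZero = All (_≈ 0ℝ)

RealRooted : Poly → Set
RealRooted p = IsZero p ⊎ (∀ z → eval p z ≈ℂ ofℝ 0ℝ → im z ≈ 0ℝ)

------------------------------------------------------------------------
-- Area sequences and their unit interval graphs.  The vertex i : Fin n is
-- the vertex toℕ i + 1 of [n], and  lookup a i  is the entry with that
-- 1-based index; hence "a_i < i" reads  lookup a i < suc (toℕ i).

IsArea : ∀ {n} → Vec ℕ n → Set
IsArea {n} a =
  (∀ i → lookup a i ℕ.< suc (toℕ i)) ×
  (∀ (i j : Fin n) → toℕ j ≡ suc (toℕ i) → lookup a j ℕ.≤ suc (lookup a i))

-- Edge a j i: the pair {j,i} with j < i is an edge.  The condition
-- i - a_i ≤ j does not change under the index shift; for an area sequence
-- the subtraction is never truncated.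
Edge : ∀ {n} → Vec ℕ n → Fin n → Fin n → Set
Edge a j i = j Fin.< i × toℕ i ℕ.∸ lookup a i ℕ.≤ toℕ j

Adj : ∀ {n} → Vec ℕ n → Fin n → Fin n → Set
Adj a i j = Edge a i j ⊎ Edge a j i

Isolated : ∀ {n} → Vec ℕ n → Fin n → Set
Isolated a i = ∀ j → ¬ Adj a i j

-- Quantifying over the vertices j′ with j′ = j + 1 makes {i, j+1} a non-edge
-- when j is the last vertex, and likewise for {i-1, j}.
PeakPair : ∀ {n} → Vec ℕ n → Fin n × Fin n → Set
PeakPair a (i , j) = Edge a i j ×
  (∀ j′ → toℕ j′ ≡ suc (toℕ j) → ¬ Adj a i j′) ×
  (∀ i′ → suc (toℕ i′) ≡ toℕ i → ¬ Adj a i′ j)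

Abelian : ∀ {m} → Vec ℕ (suc m) → Set
Abelian {m} a = ∀ i → i ≢ Fin.zero → i ≢ fromℕ m →
  Adj a i Fin.zero ⊎ Adj a i (fromℕ m)

Connected : ∀ {n} → Vec ℕ n → Set
Connected a = ∀ i j → Star (Adj a) i j

isArea? : ∀ {n} → Decidable (IsArea {n})
isArea? a =
  Fin.all? (λ i → lookup a i ℕ.<? suc (toℕ i)) ×-dec
  Fin.all? (λ i → Fin.all? λ j →
    (toℕ j ℕ.≟ suc (toℕ i)) →-dec (lookup a j ℕ.≤? suc (lookup a i)))

edge? : ∀ {n} (a : Vec ℕ n) i j → Dec (Edge a i j)
edge? a j i = (j Fin.<? i) ×-dec (toℕ i ℕ.∸ lookup a i ℕ.≤? toℕ j)

adj? : ∀ {n} (a : Vec ℕ n) i j → Dec (Adj a i j)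
adj? a i j = edge? a i j ⊎-dec edge? a j i

isolated? : ∀ {n} (a : Vec ℕ n) → Decidable (Isolated a)
isolated? a i = Fin.all? λ j → ¬? (adj? a i j)

peakPair? : ∀ {n} (a : Vec ℕ n) → Decidable (PeakPair a)
peakPair? a (i , j) = edge? a i j ×-dec
  Fin.all? (λ j′ → (toℕ j′ ℕ.≟ suc (toℕ j)) →-dec ¬? (adj? a i j′)) ×-dec
  Fin.all? (λ i′ → (suc (toℕ i′) ℕ.≟ toℕ i) →-dec ¬? (adj? a i′ j))

abelian? : ∀ {m} → Decidable (Abelian {m})
abelian? {m} a = Fin.all? λ i →
  ¬? (i Fin.≟ Fin.zero) →-dec (¬? (i Fin.≟ fromℕ m) →-dec
  (adj? a i Fin.zero ⊎-dec adj? a i (fromℕ m)))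

-- Connectedness is decidable because, for an area sequence, it holds exactly
-- when consecutive vertices are adjacent.
Consecutive : ∀ {n} → Vec ℕ n → Set
Consecutive {n} a = ∀ (i j : Fin n) → toℕ j ≡ suc (toℕ i) → Adj a i j

consecutive? : ∀ {n} → Decidable (Consecutive {n})
consecutive? a = Fin.all? λ i → Fin.all? λ j →
  (toℕ j ℕ.≟ suc (toℕ i)) →-dec adj? a i j

adj-sym : ∀ {n} (a : Vec ℕ n) {i j} → Adj a i j → Adj a j i
adj-sym a (inj₁ e) = inj₂ e
adj-sym a (inj₂ e) = inj₁ e

up : ∀ {n} (a : Vec ℕ n) → Consecutive a →
     ∀ d (i j : Fin n) → toℕ j ≡ d ℕ.+ toℕ i → Star (Adj a) i j
up a c zero    i j eq with refl ← Fin.toℕ-injective eq = ε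
up {n} a c (suc d) i j eq = up a c d i k (Fin.toℕ-fromℕ< k<n) ◅◅ (c k j k+1≡j ◅ ε)
  where
  k<n : d ℕ.+ toℕ i ℕ.< n
  k<n = ℕ.≤-trans (ℕ.≤-reflexive (sym eq)) (ℕ.<⇒≤ (Fin.toℕ<n j))
  k : Fin n
  k = Fin.fromℕ< k<n
  k+1≡j : toℕ j ≡ suc (toℕ k)
  k+1≡j = trans eq (cong suc (sym (Fin.toℕ-fromℕ< k<n)))

consecutive⇒connected : ∀ {n} (a : Vec ℕ n) → Consecutive a → Connected a
consecutive⇒connected a c i j with ℕ.≤-total (toℕ i) (toℕ j)
... | inj₁ p = up a c (toℕ j ℕ.∸ toℕ i) i j (sym (ℕ.m∸n+n≡m p))
... | inj₂ p = reverse (λ {i} {j} → adj-sym a {i} {j}) (up a c (toℕ i ℕ.∸ toℕ j) j i (sym (ℕ.m∸n+n≡m p)))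

growth : ∀ {n} (a : Vec ℕ n) → IsArea a →
         ∀ d (i j : Fin n) → toℕ j ≡ d ℕ.+ toℕ i → lookup a j ℕ.≤ d ℕ.+ lookup a i
growth a ar zero i j eq with refl ← Fin.toℕ-injective eq = ℕ.≤-refl
growth {n} a ar (suc d) i j eq =
  ℕ.≤-trans (proj₂ ar k j k+1≡j) (ℕ.s≤s (growth a ar d i k (Fin.toℕ-fromℕ< k<n)))
  where
  k<n : d ℕ.+ toℕ i ℕ.< n
  k<n = ℕ.≤-trans (ℕ.≤-reflexive (sym eq)) (ℕ.<⇒≤ (Fin.toℕ<n j))
  k : Fin n
  k = Fin.fromℕ< k<n
  k+1≡j : toℕ j ≡ suc (toℕ k)
  k+1≡j = trans eq (cong suc (sym (Fin.toℕ-fromℕ< k<n)))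

-- If a_b = 0, no edge crosses from below b to b or above.
noCross : ∀ {n} (a : Vec ℕ n) → IsArea a → ∀ b → lookup a b ≡ 0 →
          ∀ {i j} → toℕ i ℕ.< toℕ b → toℕ b ℕ.≤ toℕ j → ¬ Edge a i j
noCross a ar b ab≡0 {i} {j} i<b b≤j (_ , le) =
  ℕ.<-irrefl refl (ℕ.<-≤-trans i<b (ℕ.≤-trans b≤ le))
  where
  d = toℕ j ℕ.∸ toℕ b
  aj≤d : lookup a j ℕ.≤ d
  aj≤d = subst (lookup a j ℕ.≤_) (trans (cong (d ℕ.+_) ab≡0) (ℕ.+-identityʳ d))
           (growth a ar d b j (sym (ℕ.m∸n+n≡m b≤j)))
  b≤ : toℕ b ℕ.≤ toℕ j ℕ.∸ lookup a j
  b≤ = subst (ℕ._≤ toℕ j ℕ.∸ lookup a j) (ℕ.m∸[m∸n]≡n b≤j)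
         (ℕ.∸-monoʳ-≤ (toℕ j) aj≤d)

stays : ∀ {n} (a : Vec ℕ n) → IsArea a → ∀ b → lookup a b ≡ 0 →
        ∀ {i j} → Star (Adj a) i j → toℕ i ℕ.< toℕ b → toℕ j ℕ.< toℕ b
stays a ar b z ε p = p
stays a ar b z {i} (_◅_ {j = k} e es) p with toℕ k ℕ.<? toℕ b
... | yes q = stays a ar b z es q
... | no ¬q with e
...   | inj₁ e′ = contradiction e′ (noCross a ar b z {i} {k} p (ℕ.≮⇒≥ ¬q))
...   | inj₂ (k<i , _) = contradiction (ℕ.<-trans k<i p) ¬q

connected⇒consecutive : ∀ {n} (a : Vec ℕ n) → IsArea a → Connected a → Consecutive a
connected⇒consecutive a ar c i j eq with lookup a j in z
... | zero  = contradiction (stays a ar j z (c i j) i<j) (ℕ.<-irrefl refl)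
  where
  i<j : toℕ i ℕ.< toℕ j
  i<j = ℕ.≤-reflexive (sym eq)
... | suc k = inj₁ (ℕ.≤-reflexive (sym eq) , le)
  where
  le : toℕ j ℕ.∸ suc k ℕ.≤ toℕ i
  le rewrite eq = ℕ.m∸n≤m (toℕ i) k

connected? : ∀ {n} (a : Vec ℕ n) → IsArea a → Dec (Connected a)
connected? a ar = map′ (consecutive⇒connected a) (connected⇒consecutive a ar) (consecutive? a)

peak : ∀ {n} → Vec ℕ n → ℕ
peak {n} a =
  length (filter (isolated? a) (allFin n)) ℕ.+
  length (filter (peakPair? a) (cartesianProduct (allFin n) (allFin n)))

------------------------------------------------------------------------
-- The set 𝒜ᶜ(n) of Abelian area sequences of size n ≥ 1 with connected graph,
-- listed without repetition (see ∈-abelianSeqs and abelianSeqs-unique).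

ConnAbelianArea : ∀ {m} → Vec ℕ (suc m) → Set
ConnAbelianArea a = IsArea a × Abelian a × Connected a

connAbelianArea? : ∀ {m} → Decidable (ConnAbelianArea {m})
connAbelianArea? a with isArea? a
... | no ¬ar = no (¬ar ∘ proj₁)
... | yes ar = map′ (ar ,_) proj₂ (abelian? a ×-dec connected? a ar)

allVecs : List ℕ → ∀ n → List (Vec ℕ n)
allVecs xs zero    = [] ∷ []
allVecs xs (suc n) = cartesianProductWith _∷_ xs (allVecs xs n)

abelianSeqs : ∀ m → List (Vec ℕ (suc m))
abelianSeqs m = filter connAbelianArea? (allVecs (upTo (suc m)) (suc m))

∈-allVecs : ∀ k {n} (a : Vec ℕ n) → (∀ i → lookup a i ℕ.< k) → a ∈ allVecs (upTo k) n
∈-allVecs k []      _ = here refl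
∈-allVecs k (x ∷ a) h =
  ∈-cartesianProductWith⁺ _∷_ (∈-upTo⁺ (h Fin.zero)) (∈-allVecs k a (h ∘ Fin.suc))

allVecs-unique : ∀ k n → Unique (allVecs (upTo k) n)
allVecs-unique k zero    = All.[] ∷ []
allVecs-unique k (suc n) =
  Unique.cartesianProductWith⁺ _∷_ Vec.∷-injective (Unique.upTo⁺ k) (allVecs-unique k n)

∈-abelianSeqs : ∀ {m} (a : Vec ℕ (suc m)) → ConnAbelianArea a → a ∈ abelianSeqs m
∈-abelianSeqs {m} a h = ∈-filter⁺ connAbelianArea?
  (∈-allVecs (suc m) a λ i → ℕ.<-≤-trans (proj₁ (proj₁ h) i) (Fin.toℕ<n i)) h

abelianSeqs-sound : ∀ {m} {a : Vec ℕ (suc m)} → a ∈ abelianSeqs m → ConnAbelianArea a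
abelianSeqs-sound {m} =
  proj₂ ∘ ∈-filter⁻ connAbelianArea? {xs = allVecs (upTo (suc m)) (suc m)}

abelianSeqs-unique : ∀ m → Unique (abelianSeqs m)
abelianSeqs-unique m = Unique.filter⁺ connAbelianArea? (allVecs-unique (suc m) (suc m))

Peakᶜ : ℕ → Poly
Peakᶜ zero    = []
Peakᶜ (suc m) = sumₚ (map (λ a → t^ peak a) (abelianSeqs m))

{-# OPTIONS --safe #-}
module Submission where

-- Counting the sequences by initial run and first descent gives, for n ≥ 1,
-- Peakᶜ n = t (E n - (n - 1) t) with E n = Σⱼ C(n,2j) tʲ.  For t = - tan² θ one has
-- E n = cos (nθ) / cosⁿ θ, which for θ near jπ/n has sign (-1)ʲ and absolute value
-- about (1 + |t|)^(n/2) > (n - 1) |t|.  So f = E n - (n - 1) t alternates in sign at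
-- ⌊n/2⌋ + 1 > deg f real nodes tⱼ, and all residues of f / ∏ (t - tⱼ) are positive:
-- this quotient has no zero off the real axis.  The nodes can be taken rational,
-- on replacing π/n by the argument of a power of N + i with N large.

open import Defs hiding (_+_; _*_; -_; _-_)
import Defs as ℝ using (_+_; _*_; -_)
open import Data.Nat.Base as ℕ using (ℕ; zero; suc)
open import Algebra.Bundles using (CommutativeRing)
import Algebra.Properties.CommutativeSemiring.Exp as Exp
open import Algebra.Structures using (IsCommutativeRing)
open import Data.Fin.Base as Fin using (Fin; toℕ; fromℕ; fromℕ<; inject₁)
import Data.Fin.Properties as Fin
open import Data.List.Base as List using (List; []; _∷_; map; filter; length; allFin; cartesianProduct; _++_)
open import Data.List.Membership.Propositional using (_∈_)
open import Data.List.Membership.Propositional.Properties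
  using (∈-map⁺; ∈-map⁻; ∈-++⁺ˡ; ∈-++⁺ʳ; ∈-++⁻; ∈-filter⁺; ∈-filter⁻; ∈-allFin; ∈-cartesianProduct⁺)
open import Data.List.Membership.Propositional.Properties.WithK using (unique∧set⇒bag)
import Data.List.Properties as List
open import Data.List.Relation.Binary.BagAndSetEquality using (∼bag⇒↭)
open import Data.List.Relation.Binary.Permutation.Propositional using (_↭_)
open import Data.List.Relation.Binary.Permutation.Propositional.Properties using (↭-length)
open import Data.List.Relation.Unary.All as All using (All)
open import Data.List.Relation.Unary.AllPairs using ([]; _∷_)
open import Data.List.Relation.Unary.Any using (here; there)
open import Data.List.Relation.Unary.Unique.Propositional using (Unique)
import Data.List.Relation.Unary.Unique.Propositional.Properties as Unique
open import Data.Maybe.Base using (zipWith)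
import Data.Nat.DivMod as ℕ
import Data.Nat.Properties as ℕ
open import Data.Product.Base using (Σ; _×_; _,_; proj₁; proj₂)
open import Data.Rational.Base as ℚ using (ℚ; 0ℚ; 1ℚ; ½; 1/_; ∣_∣; _+_; _*_; -_; _-_; _≤_; _<_)
import Data.Rational.Properties as ℚ
open import Data.Sum.Base using (_⊎_; inj₁; inj₂; [_,_]′)
open import Data.Unit.Base using (⊤; tt)
open import Data.Vec.Base as Vec using (Vec; []; _∷_; lookup)
import Data.Vec.Properties as Vec
open import Function.Base using (_∘_)
open import Function.Bundles using (mk⇔)
open import Level using (0ℓ)
open import Relation.Binary.PropositionalEquality
  using (_≡_; _≢_; refl; sym; trans; cong; cong₂; subst; subst₂; isEquivalence; module ≡-Reasoning)
open import Relation.Nullary using (¬_; Dec; yes; no; contradiction)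
open import Relation.Nullary.Decidable using (dec⇒maybe; _×-dec_; _→-dec_)
open import Relation.Unary using (Decidable)
open import Tactic.RingSolver using (solve-∀)
open import Tactic.RingSolver.Core.AlmostCommutativeRing using (AlmostCommutativeRing; fromCommutativeRing)

open Exp (CommutativeRing.commutativeSemiring ℚ.+-*-commutativeRing) using (_^_; ^-distrib-*)

-- Equality of Cauchy reals cannot be decided, so instead of refuting a zero off the real axis the
-- proof gives a quantitative bound. With `y = Im w`, `Q = w f(w)` and `V = w ∏ (w - tⱼ)` over
-- `d + 1` nodes, some `c > 0` satisfies `c y^(2d+4) ≤ - y · Im (Q · conj V)`. This holds for every
-- Gaussian rational `w`, hence at each approximation of a complex `z`. If `Q` tends to 0, so does
-- the right side, `V` being bounded, and therefore so does `y`; limits enter only there. The term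
-- `(n - 1) t` comes from connectedness: at each of the `n - 1` places for the first descent, the
-- value 0 is excluded. It is all that separates `f` from `E n`, whose roots are explicit. The
-- inequality that lets the alternation survive it is proved with a margin, which pays for angles
-- that are only close to `jπ/n`.

ringℚ : AlmostCommutativeRing 0ℓ 0ℓ
ringℚ = fromCommutativeRing ℚ.+-*-commutativeRing λ x → dec⇒maybe (0ℚ ℚ.≟ x)

-- Order and powers of rational numbers

0<1 : 0ℚ < 1ℚ
0<1 = ℚ.positive⁻¹ 1ℚ

0≤1 : 0ℚ ≤ 1ℚ
0≤1 = ℚ.nonNegative⁻¹ 1ℚ

0≤+ : ∀ {a b} → 0ℚ ≤ a → 0ℚ ≤ b → 0ℚ ≤ a + b
0≤+ = ℚ.+-mono-≤

0<+ : ∀ {a b} → 0ℚ < a → 0ℚ ≤ b → 0ℚ < a + b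
0<+ = ℚ.+-mono-<-≤

0≤* : ∀ {a b} → 0ℚ ≤ a → 0ℚ ≤ b → 0ℚ ≤ a * b
0≤* {a} {b} p q = ℚ.nonNegative⁻¹ (a * b) {{ℚ.nonNeg*nonNeg⇒nonNeg a {{ℚ.nonNegative p}} b {{ℚ.nonNegative q}}}}

0<* : ∀ {a b} → 0ℚ < a → 0ℚ < b → 0ℚ < a * b
0<* {a} {b} p q = ℚ.positive⁻¹ (a * b) {{ℚ.pos*pos⇒pos a {{ℚ.positive p}} b {{ℚ.positive q}}}}

0≤a² : ∀ a → 0ℚ ≤ a * a
0≤a² a with ℚ.≤-total 0ℚ a
... | inj₁ p = 0≤* p p
... | inj₂ p = subst (0ℚ ≤_) (neg² a) (0≤* (ℚ.neg-antimono-≤ p) (ℚ.neg-antimono-≤ p))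
  where
  neg² : ∀ a → - a * - a ≡ a * a
  neg² = solve-∀ ringℚ

≤-by : ∀ {a b e} → 0ℚ ≤ e → b ≡ a + e → a ≤ b
≤-by {a} p refl = ℚ.≤-trans (ℚ.≤-reflexive (sym (ℚ.+-identityʳ a))) (ℚ.+-monoʳ-≤ a p)

<-by : ∀ {a b e} → 0ℚ < e → b ≡ a + e → a < b
<-by {a} p refl = ℚ.≤-<-trans (ℚ.≤-reflexive (sym (ℚ.+-identityʳ a))) (ℚ.+-monoʳ-< a p)

≤⇒0≤ : ∀ {a b} → a ≤ b → 0ℚ ≤ b - a
≤⇒0≤ {a} {b} p = subst (_≤ b - a) (ℚ.+-inverseʳ a) (ℚ.+-monoˡ-≤ (- a) p)

<⇒0< : ∀ {a b} → a < b → 0ℚ < b - a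
<⇒0< {a} {b} p = subst (_< b - a) (ℚ.+-inverseʳ a) (ℚ.+-monoˡ-< (- a) p)

0<⇒< : ∀ {a b} → 0ℚ < b - a → a < b
0<⇒< {a} {b} p = <-by p (restore a b)
  where
  restore : ∀ a b → b ≡ a + (b - a)
  restore = solve-∀ ringℚ

*-mono : ∀ {a b c d} → 0ℚ ≤ a → a ≤ b → 0ℚ ≤ c → c ≤ d → a * c ≤ b * d
*-mono {a} {b} {c} {d} 0≤a a≤b 0≤c c≤d =
  ≤-by (0≤+ (0≤* 0≤a (≤⇒0≤ c≤d)) (0≤* (≤⇒0≤ a≤b) (ℚ.≤-trans 0≤c c≤d))) (expand a b c d)
  where
  expand : ∀ a b c d → b * d ≡ a * c + (a * (d - c) + (b - a) * d)
  expand = solve-∀ ringℚ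

0<*⇒0< : ∀ {a b} → 0ℚ ≤ a → 0ℚ < a * b → 0ℚ < b
0<*⇒0< {a} {b} 0≤a p =
  ℚ.*-cancelˡ-<-nonNeg a {{ℚ.nonNegative 0≤a}} (subst (_< a * b) (sym (ℚ.*-zeroʳ a)) p)

a²<b²⇒a<b : ∀ {a b} → 0ℚ ≤ b → a * a < b * b → a < b
a²<b²⇒a<b {a} {b} 0≤b p with a ℚ.<? b
... | yes q = q
... | no ¬q = contradiction (ℚ.<-≤-trans p (*-mono 0≤b (ℚ.≮⇒≥ ¬q) 0≤b (ℚ.≮⇒≥ ¬q))) (ℚ.<-irrefl refl)

^-pos : ∀ {a} n → 0ℚ < a → 0ℚ < a ^ n
^-pos zero    p = 0<1
^-pos (suc n) p = 0<* p (^-pos n p)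

^-nonNeg : ∀ {a} n → 0ℚ ≤ a → 0ℚ ≤ a ^ n
^-nonNeg zero    p = 0≤1
^-nonNeg (suc n) p = 0≤* p (^-nonNeg n p)

^-mono : ∀ {a b} n → 0ℚ ≤ a → a ≤ b → a ^ n ≤ b ^ n
^-mono zero    p q = ℚ.≤-refl
^-mono (suc n) p q = *-mono p q (^-nonNeg n p) (^-mono n p q)

ι : ℕ → ℚ
ι zero    = 0ℚ
ι (suc n) = 1ℚ + ι n

0≤ι : ∀ n → 0ℚ ≤ ι n
0≤ι zero    = ℚ.≤-refl
0≤ι (suc n) = 0≤+ 0≤1 (0≤ι n)

0<ι : ∀ n → 0ℚ < ι (suc n)
0<ι n = 0<+ 0<1 (0≤ι n)

ι-mono : ∀ {m n} → m ℕ.≤ n → ι m ≤ ι n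
ι-mono {n = n} ℕ.z≤n = 0≤ι n
ι-mono (ℕ.s≤s p)     = ℚ.+-monoʳ-≤ 1ℚ (ι-mono p)

ι-+ : ∀ m n → ι (m ℕ.+ n) ≡ ι m + ι n
ι-+ zero    n = sym (ℚ.+-identityˡ (ι n))
ι-+ (suc m) n = trans (cong (1ℚ +_) (ι-+ m n)) (sym (ℚ.+-assoc 1ℚ (ι m) (ι n)))

ι-* : ∀ m n → ι (m ℕ.* n) ≡ ι m * ι n
ι-* zero    n = sym (ℚ.*-zeroˡ (ι n))
ι-* (suc m) n = trans (ι-+ n (m ℕ.* n)) (trans (cong (ι n +_) (ι-* m n)) (expand (ι m) (ι n)))
  where
  expand : ∀ a b → b + a * b ≡ (1ℚ + a) * b
  expand = solve-∀ ringℚ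

-- Gaussian rationals

infix 4 _,i_
record ℚ[i] : Set where
  constructor _,i_
  field
    Re Im : ℚ
open ℚ[i] public

infixl 6 _⊕_
infixl 7 _⊗_
infix  8 ⊝_

_⊕_ _⊗_ : ℚ[i] → ℚ[i] → ℚ[i]
z ⊕ w = Re z + Re w ,i Im z + Im w
z ⊗ w = Re z * Re w - Im z * Im w ,i Re z * Im w + Im z * Re w

⊝_ : ℚ[i] → ℚ[i]
⊝ z = - Re z ,i - Im z

ofℚ : ℚ → ℚ[i]
ofℚ x = x ,i 0ℚ

0𝕚 1𝕚 : ℚ[i]
0𝕚 = ofℚ 0ℚ
1𝕚 = ofℚ 1ℚ

conj : ℚ[i] → ℚ[i]
conj z = Re z ,i - Im z

norm : ℚ[i] → ℚ
norm z = Re z * Re z + Im z * Im z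

ℚ[i]-isCommutativeRing : IsCommutativeRing _≡_ _⊕_ _⊗_ ⊝_ 0𝕚 1𝕚
ℚ[i]-isCommutativeRing = record
  { isRing = record
    { +-isAbelianGroup = record
      { isGroup = record
        { isMonoid = record
          { isSemigroup = record
            { isMagma = record { isEquivalence = isEquivalence ; ∙-cong = cong₂ _⊕_ }
            ; assoc   = λ x y z → cong₂ _,i_ (ℚ.+-assoc (Re x) (Re y) (Re z)) (ℚ.+-assoc (Im x) (Im y) (Im z))
            }
          ; identity = (λ x → cong₂ _,i_ (ℚ.+-identityˡ (Re x)) (ℚ.+-identityˡ (Im x)))
                     , (λ x → cong₂ _,i_ (ℚ.+-identityʳ (Re x)) (ℚ.+-identityʳ (Im x)))
          }
        ; inverse = (λ x → cong₂ _,i_ (ℚ.+-inverseˡ (Re x)) (ℚ.+-inverseˡ (Im x)))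
                  , (λ x → cong₂ _,i_ (ℚ.+-inverseʳ (Re x)) (ℚ.+-inverseʳ (Im x)))
        ; ⁻¹-cong = cong ⊝_
        }
      ; comm = λ x y → cong₂ _,i_ (ℚ.+-comm (Re x) (Re y)) (ℚ.+-comm (Im x) (Im y))
      }
    ; *-cong     = cong₂ _⊗_
    ; *-assoc    = λ x y z → cong₂ _,i_ (assocRe (Re x) (Im x) (Re y) (Im y) (Re z) (Im z))
                                        (assocIm (Re x) (Im x) (Re y) (Im y) (Re z) (Im z))
    ; *-identity = (λ x → cong₂ _,i_ (idˡRe (Re x) (Im x)) (idˡIm (Re x) (Im x)))
                 , (λ x → cong₂ _,i_ (idʳRe (Re x) (Im x)) (idʳIm (Re x) (Im x)))
    ; distrib    = (λ x y z → cong₂ _,i_ (distˡRe (Re x) (Im x) (Re y) (Im y) (Re z) (Im z))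
                                         (distˡIm (Re x) (Im x) (Re y) (Im y) (Re z) (Im z)))
                 , (λ x y z → cong₂ _,i_ (distʳRe (Re x) (Im x) (Re y) (Im y) (Re z) (Im z))
                                         (distʳIm (Re x) (Im x) (Re y) (Im y) (Re z) (Im z)))
    }
  ; *-comm = λ x y → cong₂ _,i_ (commRe (Re x) (Im x) (Re y) (Im y)) (commIm (Re x) (Im x) (Re y) (Im y))
  }
  where
  assocRe : ∀ a b c d e f → (a * c - b * d) * e - (a * d + b * c) * f ≡ a * (c * e - d * f) - b * (c * f + d * e)
  assocRe = solve-∀ ringℚ
  assocIm : ∀ a b c d e f → (a * c - b * d) * f + (a * d + b * c) * e ≡ a * (c * f + d * e) + b * (c * e - d * f)
  assocIm = solve-∀ ringℚ
  idˡRe : ∀ a b → 1ℚ * a - 0ℚ * b ≡ a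
  idˡRe = solve-∀ ringℚ
  idˡIm : ∀ a b → 1ℚ * b + 0ℚ * a ≡ b
  idˡIm = solve-∀ ringℚ
  idʳRe : ∀ a b → a * 1ℚ - b * 0ℚ ≡ a
  idʳRe = solve-∀ ringℚ
  idʳIm : ∀ a b → a * 0ℚ + b * 1ℚ ≡ b
  idʳIm = solve-∀ ringℚ
  distˡRe : ∀ a b c d e f → a * (c + e) - b * (d + f) ≡ a * c - b * d + (a * e - b * f)
  distˡRe = solve-∀ ringℚ
  distˡIm : ∀ a b c d e f → a * (d + f) + b * (c + e) ≡ a * d + b * c + (a * f + b * e)
  distˡIm = solve-∀ ringℚ
  distʳRe : ∀ a b c d e f → (c + e) * a - (d + f) * b ≡ c * a - d * b + (e * a - f * b)
  distʳRe = solve-∀ ringℚ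
  distʳIm : ∀ a b c d e f → (c + e) * b + (d + f) * a ≡ c * b + d * a + (e * b + f * a)
  distʳIm = solve-∀ ringℚ
  commRe : ∀ a b c d → a * c - b * d ≡ c * a - d * b
  commRe = solve-∀ ringℚ
  commIm : ∀ a b c d → a * d + b * c ≡ c * b + d * a
  commIm = solve-∀ ringℚ

ℚ[i]-commutativeRing : CommutativeRing 0ℓ 0ℓ
ℚ[i]-commutativeRing = record { isCommutativeRing = ℚ[i]-isCommutativeRing }

open Exp (CommutativeRing.commutativeSemiring ℚ[i]-commutativeRing) using (^-homo-*; ^-assocʳ) renaming (_^_ to _^𝕚_)

ring𝕚 : AlmostCommutativeRing 0ℓ 0ℓ
ring𝕚 = fromCommutativeRing ℚ[i]-commutativeRing λ z →
  zipWith (λ p q → cong₂ _,i_ p q) (dec⇒maybe (0ℚ ℚ.≟ Re z)) (dec⇒maybe (0ℚ ℚ.≟ Im z))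

-- Polynomial functions

-- Polynomials are kept as functions in Horner form, up to pointwise equality, so degree bounds pass
-- through sums, products and exact division without a normal form for coefficients.
Deg< : ℕ → (ℚ[i] → ℚ[i]) → Set
Deg< zero    f = ∀ w → f w ≡ 0𝕚
Deg< (suc k) f = Σ ℚ[i] λ c → Σ (ℚ[i] → ℚ[i]) λ g → Deg< k g × (∀ w → f w ≡ c ⊕ w ⊗ g w)

deg-cong : ∀ k {f g} → (∀ w → f w ≡ g w) → Deg< k g → Deg< k f
deg-cong zero    e h               w = trans (e w) (h w)
deg-cong (suc k) e (c , g , dg , h)  = c , g , dg , λ w → trans (e w) (h w)

deg-suc : ∀ k {f} → Deg< k f → Deg< (suc k) f
deg-suc zero    h                = 0𝕚 , (λ _ → 0𝕚) , (λ _ → refl) , λ w → trans (h w) (sym (zeroes w))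
  where
  zeroes : ∀ w → 0𝕚 ⊕ w ⊗ 0𝕚 ≡ 0𝕚
  zeroes = solve-∀ ring𝕚
deg-suc (suc k) (c , g , dg , h) = c , g , deg-suc k dg , h

deg-t* : ∀ k {f} → Deg< k f → Deg< (suc k) (λ w → w ⊗ f w)
deg-t* k {f} df = 0𝕚 , f , df , λ w → shift w (f w)
  where
  shift : ∀ w v → w ⊗ v ≡ 0𝕚 ⊕ w ⊗ v
  shift = solve-∀ ring𝕚

deg-+ : ∀ k a {f g} → Deg< k f → Deg< k g → Deg< k (λ w → f w ⊕ a ⊗ g w)
deg-+ zero    a df dg w = trans (cong₂ (λ u v → u ⊕ a ⊗ v) (df w) (dg w)) (zeroes a)
  where
  zeroes : ∀ a → 0𝕚 ⊕ a ⊗ 0𝕚 ≡ 0𝕚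
  zeroes = solve-∀ ring𝕚
deg-+ (suc k) a (c , f′ , df , hf) (d , g′ , dg , hg) =
  c ⊕ a ⊗ d , _ , deg-+ k a df dg , λ w →
  trans (cong₂ (λ u v → u ⊕ a ⊗ v) (hf w) (hg w)) (collect a c d w (f′ w) (g′ w))
  where
  collect : ∀ a c d w u v → c ⊕ w ⊗ u ⊕ a ⊗ (d ⊕ w ⊗ v) ≡ c ⊕ a ⊗ d ⊕ w ⊗ (u ⊕ a ⊗ v)
  collect = solve-∀ ring𝕚

deg-[t-x]* : ∀ k x {f} → Deg< k f → Deg< (suc k) (λ w → (w ⊕ x) ⊗ f w)
deg-[t-x]* k x {f} df =
  deg-cong (suc k) (λ w → expand w x (f w)) (deg-+ (suc k) x (deg-t* k df) (deg-suc k df))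
  where
  expand : ∀ w x v → (w ⊕ x) ⊗ v ≡ w ⊗ v ⊕ x ⊗ v
  expand = solve-∀ ring𝕚

-- Synthetic division by `t - x`: for `c + t g` the quotient is `g x + t g₂`, where `g₂` is the
-- quotient of `g`.
factor : ∀ k x {f} → Deg< (suc k) f →
         Σ (ℚ[i] → ℚ[i]) λ g → Deg< k g × (∀ w → f w ≡ f x ⊕ (w ⊕ ⊝ x) ⊗ g w)
factor zero x (c , g , dg , h) = (λ _ → 0𝕚) , (λ _ → refl) , λ w → trans (const w) (trans (sym (const x)) (pad _ w x))
  where
  absorb : ∀ c w → c ⊕ w ⊗ 0𝕚 ≡ c
  absorb = solve-∀ ring𝕚
  const : ∀ w → _ ≡ c
  const w = trans (h w) (trans (cong (λ v → c ⊕ w ⊗ v) (dg w)) (absorb c w))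
  pad : ∀ c w x → c ≡ c ⊕ (w ⊕ ⊝ x) ⊗ 0𝕚
  pad = solve-∀ ring𝕚
factor (suc k) x {f} (c , g , dg , h) with factor k x dg
... | g₂ , dg₂ , h₂ = (λ w → g x ⊕ w ⊗ g₂ w) , (g x , g₂ , dg₂ , λ _ → refl) , λ w → begin
  f w                                                        ≡⟨ h w ⟩
  c ⊕ w ⊗ g w                                                ≡⟨ cong (λ v → c ⊕ w ⊗ v) (h₂ w) ⟩
  c ⊕ w ⊗ (g x ⊕ (w ⊕ ⊝ x) ⊗ g₂ w)                           ≡⟨ regroup c w x (g x) (g₂ w) ⟩
  c ⊕ x ⊗ g x ⊕ (w ⊕ ⊝ x) ⊗ (g x ⊕ w ⊗ g₂ w)                 ≡⟨ cong (_⊕ _) (h x) ⟨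
  f x ⊕ (w ⊕ ⊝ x) ⊗ (g x ⊕ w ⊗ g₂ w)                         ∎
  where
  open ≡-Reasoning
  regroup : ∀ c w x u v → c ⊕ w ⊗ (u ⊕ (w ⊕ ⊝ x) ⊗ v) ≡ c ⊕ x ⊗ u ⊕ (w ⊕ ⊝ x) ⊗ (u ⊕ w ⊗ v)
  regroup = solve-∀ ring𝕚

-- Polynomials alternating in sign at rational nodes

sg : ℕ → ℚ
sg zero    = 1ℚ
sg (suc k) = - sg k

sg² : ∀ k → sg k * sg k ≡ 1ℚ
sg² zero    = refl
sg² (suc k) = trans (neg² (sg k)) (sg² k)
  where
  neg² : ∀ a → - a * - a ≡ a * a
  neg² = solve-∀ ringℚ

inverse : ∀ {r} → 0ℚ < r → Σ ℚ λ s → 0ℚ < s × r * s ≡ 1ℚ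
inverse {r} 0<r = 1/ r , ℚ.positive⁻¹ (1/ r) {{ℚ.1/pos⇒pos r}} , ℚ.*-inverseʳ r
  where
  instance
    _ = ℚ.positive 0<r
    _ = ℚ.pos⇒nonZero r

ofℚ-cancel : ∀ {r s} v {z} → r * s ≡ 1ℚ → ofℚ r ⊗ z ≡ ofℚ v → z ≡ ofℚ (s * v)
ofℚ-cancel {r} {s} v {a ,i b} rs e = cong₂ _,i_
  (trans (unit a) (trans (assocRe r s a b) (cong (λ z → s * Re z) e)))
  (trans (unit b) (trans (assocIm r s a b) (trans (cong (λ z → s * Im z) e) (ℚ.*-zeroʳ s))))
  where
  unit : ∀ a → a ≡ r * s * a
  unit a = trans (sym (ℚ.*-identityˡ a)) (cong (_* a) (sym rs))
  assocRe : ∀ r s a b → r * s * a ≡ s * (r * a - 0ℚ * b)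
  assocRe = solve-∀ ringℚ
  assocIm : ∀ r s a b → r * s * b ≡ s * (r * b + 0ℚ * a)
  assocIm = solve-∀ ringℚ

module Nodes (x : ℕ → ℚ) where

  ∏ : ℕ → ℚ[i] → ℚ[i]
  ∏ zero    w = 1𝕚
  ∏ (suc k) w = (w ⊕ ofℚ (- x k)) ⊗ ∏ k w

  deg-∏ : ∀ k → Deg< (suc k) (∏ k)
  deg-∏ zero    = 1𝕚 , (λ _ → 0𝕚) , (λ _ → refl) , one
    where
    one : ∀ w → 1𝕚 ≡ 1𝕚 ⊕ w ⊗ 0𝕚
    one = solve-∀ ring𝕚
  deg-∏ (suc k) = deg-[t-x]* (suc k) (ofℚ (- x k)) (deg-∏ k)

  ∏-root : ∀ k i → i ℕ.< k → ∏ k (ofℚ (x i)) ≡ 0𝕚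
  ∏-root (suc k) i (ℕ.s≤s i≤k) with i ℕ.≟ k
  ... | yes refl = trans (cong (_⊗ ∏ k (ofℚ (x k))) (cong ofℚ (ℚ.+-inverseʳ (x k)))) (zeroˡ (∏ k (ofℚ (x k))))
    where
    zeroˡ : ∀ w → 0𝕚 ⊗ w ≡ 0𝕚
    zeroˡ = solve-∀ ring𝕚
  ... | no i≢k = trans (cong ((ofℚ (x i) ⊕ ofℚ (- x k)) ⊗_) (∏-root k i (ℕ.≤∧≢⇒< i≤k i≢k))) (zeroʳ (ofℚ (x i) ⊕ ofℚ (- x k)))
    where
    zeroʳ : ∀ w → w ⊗ 0𝕚 ≡ 0𝕚
    zeroʳ = solve-∀ ring𝕚

  ∏-alternates : ∀ k y → (∀ j → j ℕ.< k → y < x j) →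
                 Σ ℚ λ v → ∏ k (ofℚ y) ≡ ofℚ v × 0ℚ < sg k * v
  ∏-alternates zero    y y< = 1ℚ , refl , 0<1
  ∏-alternates (suc k) y y< with ∏-alternates k y (λ j j<k → y< j (ℕ.m≤n⇒m≤1+n j<k))
  ... | v , e , 0<v = (y - x k) * v
    , trans (cong (λ w → (ofℚ y ⊕ ofℚ (- x k)) ⊗ w) e) (cong₂ _,i_ (real y (x k) v) (imag y (x k) v))
    , subst (0ℚ <_) (flip (sg k) v y (x k)) (0<* 0<v (<⇒0< (y< k ℕ.≤-refl)))
    where
    real : ∀ y x v → (y - x) * v - (0ℚ + 0ℚ) * 0ℚ ≡ (y - x) * v
    real = solve-∀ ringℚ
    imag : ∀ y x v → (y - x) * 0ℚ + (0ℚ + 0ℚ) * v ≡ 0ℚ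
    imag = solve-∀ ringℚ
    flip : ∀ s v y x → s * v * (x - y) ≡ - s * ((y - x) * v)
    flip = solve-∀ ringℚ

  -- Each factor `w - x j` has a real node, hence modulus at least `|Im w|`.
  norm-∏ : ∀ k w → (Im w * Im w) ^ k ≤ norm (∏ k w)
  norm-∏ zero    w = ℚ.≤-refl
  norm-∏ (suc k) w = ℚ.≤-trans
    (*-mono (0≤a² (Im w)) (≤-by (0≤a² (Re w - x k)) (ℚ.+-comm ((Re w - x k) * (Re w - x k)) (Im w * Im w)))
            (^-nonNeg k (0≤a² (Im w))) (norm-∏ k w))
    (ℚ.≤-reflexive (multiplicative (Re w - x k) (Im w) (Re (∏ k w)) (Im (∏ k w))))
    where
    multiplicative : ∀ a b c d → (a * a + b * b) * (c * c + d * d) ≡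
      (a * c - (b + 0ℚ) * d) * (a * c - (b + 0ℚ) * d) + (a * d + (b + 0ℚ) * c) * (a * d + (b + 0ℚ) * c)
    multiplicative = solve-∀ ringℚ

  Alternates : ℕ → (ℚ[i] → ℚ[i]) → Set
  Alternates k f = ∀ i → i ℕ.< k → Σ ℚ λ v → f (ofℚ (x i)) ≡ ofℚ v × 0ℚ < sg i * v

  -- The size guaranteed for the sum of residue terms. Without nodes that sum is empty, whence the
  -- value 0.
  lower : ℕ → ℚ[i] → ℚ
  lower zero    w = 0ℚ
  lower (suc k) w = (Im w * Im w) ^ k

  lower-nonNeg : ∀ k w → 0ℚ ≤ lower k w
  lower-nonNeg zero    w = ℚ.≤-refl
  lower-nonNeg (suc k) w = ^-nonNeg k (0≤a² (Im w))

  Decreasing : ℕ → Set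
  Decreasing k = ∀ i j → i ℕ.< j → j ℕ.< k → x j < x i

  -- `c` is the residue of `f / ∏ (suc k)` at `x k`. It is positive because `x k` lies left of the
  -- earlier nodes, so that `∏ k` has there the sign `(-1)ᵏ`, which `f` has as well.
  residue : ∀ k f → Decreasing (suc k) → Alternates (suc k) f →
            Σ ℚ λ c → 0ℚ < c × f (ofℚ (x k)) ⊕ ofℚ (- c) ⊗ ∏ k (ofℚ (x k)) ≡ 0𝕚
  residue k f decr alt =
    let v , fx , 0<v = alt k ℕ.≤-refl
        δ , ∏x , 0<δ = ∏-alternates k (x k) (λ j j<k → decr j k j<k ℕ.≤-refl)
        s , 0<s , δs = inverse 0<δ
    -- As `s` inverts `sg k * δ`, this is `v / δ` written as a product of two positive numbers.
    in sg k * v * s , 0<* 0<v 0<s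
     , trans (cong₂ (λ a b → a ⊕ ofℚ (- (sg k * v * s)) ⊗ b) fx ∏x)
             (cong₂ _,i_ (trans (cancel (sg k) v s δ)
                           (trans (cong₂ (λ a b → v - a * v * b + (a - 1ℚ) * (sg k * v * s * δ)) (sg² k) δs)
                                  (units v (sg k * v * s * δ))))
                         (imag (sg k * v * s) δ))
    where
    cancel : ∀ g v s d → v + ((- (g * v * s)) * d - 0ℚ * 0ℚ) ≡
                         v - g * g * v * (g * d * s) + (g * g - 1ℚ) * (g * v * s * d)
    cancel = solve-∀ ringℚ
    units : ∀ v e → v - 1ℚ * v * 1ℚ + (1ℚ - 1ℚ) * e ≡ 0ℚ
    units = solve-∀ ringℚ
    imag : ∀ c d → 0ℚ + ((- c) * 0ℚ + 0ℚ * d) ≡ 0ℚ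
    imag = solve-∀ ringℚ

  -- One partial fraction is split off: `f / ∏ (suc k) = c / (t - x k) + g / ∏ k`. At the earlier
  -- nodes `g` is `f` divided by the positive number `x i - x k`, so it alternates again and the
  -- step can be iterated.
  split : ∀ k f → Deg< (suc k) f → Decreasing (suc k) → Alternates (suc k) f →
    Σ ℚ λ c → 0ℚ < c × Σ (ℚ[i] → ℚ[i]) λ g → Deg< k g × Alternates k g ×
    (∀ w → f w ≡ ofℚ c ⊗ ∏ k w ⊕ (w ⊕ ofℚ (- x k)) ⊗ g w)
  split k f df decr alt = c , proj₁ (proj₂ res) , g , dg , alt-g , f≡
    where
    res = residue k f decr alt
    c = proj₁ res
    fac = factor k (ofℚ (x k)) (deg-+ (suc k) (ofℚ (- c)) df (deg-∏ k))
    g = proj₁ fac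
    dg = proj₁ (proj₂ fac)
    rest : ∀ w → f w ⊕ ofℚ (- c) ⊗ ∏ k w ≡ (w ⊕ ofℚ (- x k)) ⊗ g w
    rest w = trans (proj₂ (proj₂ fac) w)
               (trans (cong (_⊕ (w ⊕ ofℚ (- x k)) ⊗ g w) (proj₂ (proj₂ res))) (zeroˡ ((w ⊕ ofℚ (- x k)) ⊗ g w)))
      where
      zeroˡ : ∀ w → 0𝕚 ⊕ w ≡ w
      zeroˡ = solve-∀ ring𝕚
    f≡ : ∀ w → f w ≡ ofℚ c ⊗ ∏ k w ⊕ (w ⊕ ofℚ (- x k)) ⊗ g w
    f≡ w = trans (move (f w) (ofℚ c) (∏ k w)) (cong (ofℚ c ⊗ ∏ k w ⊕_) (rest w))
      where
      move : ∀ u c d → u ≡ c ⊗ d ⊕ (u ⊕ (⊝ c) ⊗ d)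
      move = solve-∀ ring𝕚
    alt-g : Alternates k g
    alt-g i i<k =
      let u , fxᵢ , 0<u = alt i (ℕ.m≤n⇒m≤1+n i<k)
          t , 0<t , xt  = inverse (<⇒0< (decr i k i<k ℕ.≤-refl))
      in t * u
       , ofℚ-cancel {x i - x k} u xt (trans (sym (rest (ofℚ (x i)))) (trans
           (cong₂ (λ a b → a ⊕ ofℚ (- c) ⊗ b) fxᵢ (∏-root k i i<k)) (zeroʳ (ofℚ u) (ofℚ (- c)))))
       , subst (0ℚ <_) (swap t (sg i) u) (0<* 0<t 0<u)
      where
      zeroʳ : ∀ u c → u ⊕ c ⊗ 0𝕚 ≡ u
      zeroʳ = solve-∀ ring𝕚
      swap : ∀ t g u → t * (g * u) ≡ g * (t * u)
      swap = solve-∀ ringℚ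

  -- The partial fraction expansion of f / ∏ k has positive residues, so the
  -- quotient maps the upper half-plane into the lower one.
  alternating : ∀ k f → Deg< k f → Decreasing k → Alternates k f →
    Σ (ℚ[i] → ℚ) λ S → (∀ w → Im (f w ⊗ conj (∏ k w)) ≡ - (Im w * S w)) ×
    Σ ℚ λ c → 0ℚ < c × (∀ w → c * lower k w ≤ S w)
  alternating zero f df _ _ =
    (λ _ → 0ℚ) , (λ w → trans (cong (λ v → Im (v ⊗ conj 1𝕚)) (df w)) (zeroes (Im w))) , 1ℚ , 0<1 , λ w → ℚ.≤-refl
    where
    zeroes : ∀ y → 0ℚ * (- 0ℚ) + 0ℚ * 1ℚ ≡ - (y * 0ℚ)
    zeroes = solve-∀ ringℚ
  alternating (suc k) f df decr alt =
    let c , 0<c , g , dg , alt-g , f≡ = split k f df decr alt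
        S , id-S , d , 0<d , bound    =
          alternating k g dg (λ i j i<j j<k → decr i j i<j (ℕ.m≤n⇒m≤1+n j<k)) alt-g
    -- By induction this is `|∏ (suc k)|² · Σ cᵢ / |w - xᵢ|²`, written without division. The lower
    -- bound keeps only the term of `x k`.
    in (λ w → c * norm (∏ k w) + norm (w ⊕ ofℚ (- x k)) * S w)
     , (λ w → trans (cong (λ u → Im (u ⊗ conj (∏ (suc k) w))) (f≡ w))
         (trans (expand (Re w - x k) (Im w) c (Re (∏ k w)) (Im (∏ k w)) (Re (g w)) (Im (g w)))
         (trans (cong (λ u → - (Im w * (c * norm (∏ k w))) + norm (w ⊕ ofℚ (- x k)) * u) (id-S w))
                (collect (Im w) (c * norm (∏ k w)) (norm (w ⊕ ofℚ (- x k))) (S w)))))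
     , c , 0<c
     , λ w → ≤-by
         (0≤+ (0≤* (ℚ.<⇒≤ 0<c) (≤⇒0≤ (norm-∏ k w)))
              (0≤* (0≤norm (w ⊕ ofℚ (- x k)))
                   (ℚ.≤-trans (0≤* (ℚ.<⇒≤ 0<d) (lower-nonNeg k w)) (bound w))))
         (regroup c ((Im w * Im w) ^ k) (norm (∏ k w)) (norm (w ⊕ ofℚ (- x k)) * S w))
    where
    0≤norm : ∀ w → 0ℚ ≤ norm w
    0≤norm w = 0≤+ (0≤a² (Re w)) (0≤a² (Im w))
    collect : ∀ y a n s → - (y * a) + n * - (y * s) ≡ - (y * (a + n * s))
    collect = solve-∀ ringℚ
    expand : ∀ a b c p q g h →
      (c * p - 0ℚ * q + (a * g - (b + 0ℚ) * h)) * (- (a * q + (b + 0ℚ) * p)) +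
      (c * q + 0ℚ * p + (a * h + (b + 0ℚ) * g)) * (a * p - (b + 0ℚ) * q) ≡
      - (b * (c * (p * p + q * q))) + (a * a + (b + 0ℚ) * (b + 0ℚ)) * (g * (- q) + h * p)
    expand = solve-∀ ringℚ
    regroup : ∀ c l n r → c * n + r ≡ c * l + (c * (n - l) + r)
    regroup = solve-∀ ringℚ

-- Rotation by an angle slightly below π / n

2ℚ : ℚ
2ℚ = 1ℚ + 1ℚ

0<2 : 0ℚ < 2ℚ
0<2 = 0<+ 0<1 0≤1

-- From `tan (arg z) ≤ 1/c` follows `tan (j · arg z) ≤ 2j/c`. The addition formula divides by
-- `1 - tan · tan`; the factor 2 pays for this as long as `2j ≤ c`.
small-angle : ∀ c z → 0ℚ < Re z → 0ℚ ≤ Im z → c * Im z ≤ Re z → ∀ j → 2ℚ * ι j ≤ c →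
  0ℚ < Re (z ^𝕚 j) × 0ℚ ≤ Im (z ^𝕚 j) × c * Im (z ^𝕚 j) ≤ 2ℚ * ι j * Re (z ^𝕚 j)
small-angle c z 0<A 0≤B cB≤A zero    _   = 0<1 , ℚ.≤-refl , ℚ.≤-reflexive (zeroes c)
  where
  zeroes : ∀ c → c * 0ℚ ≡ (1ℚ + 1ℚ) * 0ℚ * 1ℚ
  zeroes = solve-∀ ringℚ
small-angle c z 0<A 0≤B cB≤A (suc j) hyp = 0<R′ , 0≤I′ , slope
  where
  A = Re z
  B = Im z
  R = Re (z ^𝕚 j)
  I = Im (z ^𝕚 j)
  J = 2ℚ * ι j
  rec = small-angle c z 0<A 0≤B cB≤A j (ℚ.≤-trans (≤-by (ℚ.<⇒≤ 0<2) (step (ι j))) hyp)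
    where
    step : ∀ j → (1ℚ + 1ℚ) * (1ℚ + j) ≡ (1ℚ + 1ℚ) * j + (1ℚ + 1ℚ)
    step = solve-∀ ringℚ
  0<R = proj₁ rec
  0≤I = proj₁ (proj₂ rec)
  cI≤JR = proj₂ (proj₂ rec)
  0≤A = ℚ.<⇒≤ 0<A
  0≤R = ℚ.<⇒≤ 0<R
  0≤J : 0ℚ ≤ J
  0≤J = 0≤* (ℚ.<⇒≤ 0<2) (0≤ι j)
  0<c : 0ℚ < c
  0<c = ℚ.<-≤-trans (0<* 0<2 (0<ι j)) hyp
  0≤X : 0ℚ ≤ B * I
  0≤X = 0≤* 0≤B 0≤I
  -- Since `J + 2 ≤ c` and `c² B I ≤ J A R`, one has `(2 + J) B I ≤ c B I ≤ (J / c) A R`.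
  gap : (2ℚ + J) * (B * I) ≤ A * R
  gap = ℚ.*-cancelˡ-≤-pos c {{ℚ.positive 0<c}} (≤-by
    (0≤+ (0≤+ (≤⇒0≤ (*-mono (0≤* (ℚ.<⇒≤ 0<c) 0≤B) cB≤A (0≤* (ℚ.<⇒≤ 0<c) 0≤I) cI≤JR))
              (0≤* (≤⇒0≤ hyp) (0≤+ (0≤* (ℚ.<⇒≤ 0<c) 0≤X) (0≤* 0≤A 0≤R))))
         (0≤* (ℚ.<⇒≤ 0<2) (0≤* 0≤A 0≤R)))
    (cert A B R I c (ι j)))
    where
    cert : ∀ A B R I c j → c * (A * R) ≡ c * ((1ℚ + 1ℚ + (1ℚ + 1ℚ) * j) * (B * I)) +
      (A * ((1ℚ + 1ℚ) * j * R) - c * B * (c * I) +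
       (c - (1ℚ + 1ℚ) * (1ℚ + j)) * (c * (B * I) + A * R) + (1ℚ + 1ℚ) * (A * R))
    cert = solve-∀ ringℚ
  0<R′ : 0ℚ < A * R - B * I
  0<R′ = 0<*⇒0< (ℚ.<⇒≤ 0<2) (subst (0ℚ <_) (cert A B R I J)
    (0<+ (0<* 0<A 0<R) (0≤+ (≤⇒0≤ gap) (0≤* 0≤J 0≤X))))
    where
    cert : ∀ A B R I J → A * R + (A * R - (1ℚ + 1ℚ + J) * (B * I) + J * (B * I)) ≡ (1ℚ + 1ℚ) * (A * R - B * I)
    cert = solve-∀ ringℚ
  0≤I′ : 0ℚ ≤ A * I + B * R
  0≤I′ = 0≤+ (0≤* 0≤A 0≤I) (0≤* 0≤B 0≤R)
  slope : c * (A * I + B * R) ≤ 2ℚ * ι (suc j) * (A * R - B * I)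
  slope = ≤-by (0≤+ (0≤+ (0≤* 0≤A (≤⇒0≤ cI≤JR)) (0≤* (≤⇒0≤ cB≤A) 0≤R)) (≤⇒0≤ gap)) (cert A B R I c (ι j))
    where
    cert : ∀ A B R I c j → (1ℚ + 1ℚ) * (1ℚ + j) * (A * R - B * I) ≡ c * (A * I + B * R) +
      (A * ((1ℚ + 1ℚ) * j * R - c * I) + (A - c * B) * R + (A * R - (1ℚ + 1ℚ + (1ℚ + 1ℚ) * j) * (B * I)))
    cert = solve-∀ ringℚ

small-angle-pos : ∀ c z → 0ℚ < Re z → 0ℚ < Im z → c * Im z ≤ Re z → ∀ j → 2ℚ * ι (suc j) ≤ c →
  0ℚ < Im (z ^𝕚 suc j)
small-angle-pos c z 0<A 0<B cB≤A j hyp =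
  let 0<R , 0≤I , _ = small-angle c z 0<A (ℚ.<⇒≤ 0<B) cB≤A j (ℚ.≤-trans (≤-by (ℚ.<⇒≤ 0<2) (step (ι j))) hyp)
  in subst (0ℚ <_) (ℚ.+-comm (Im z * Re (z ^𝕚 j)) (Re z * Im (z ^𝕚 j))) (0<+ (0<* 0<B 0<R) (0≤* (ℚ.<⇒≤ 0<A) 0≤I))
  where
  step : ∀ j → (1ℚ + 1ℚ) * (1ℚ + j) ≡ (1ℚ + 1ℚ) * j + (1ℚ + 1ℚ)
  step = solve-∀ ringℚ

first-failure : ∀ {P : ℕ → Set} → (∀ j → Dec (P j)) → ∀ M →
  (∀ j → j ℕ.< M → P j) ⊎ Σ ℕ λ k → (∀ j → j ℕ.< k → P j) × ¬ P k
first-failure P? zero = inj₁ λ _ ()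
first-failure P? (suc M) with first-failure P? M
... | inj₂ found = inj₂ found
... | inj₁ all with P? M
...   | no ¬p = inj₂ (M , all , ¬p)
...   | yes p = inj₁ λ j j≤M → [ (λ j<M → all j j<M) , (λ { refl → p }) ]′ (ℕ.m≤n⇒m<n∨m≡n (ℕ.s≤s⁻¹ j≤M))

double : ∀ z j → z ^𝕚 (j ℕ.+ j) ≡ z ^𝕚 j ⊗ z ^𝕚 j
double z j = ^-homo-* z j j

-- The double-angle formula: the imaginary part of a square is `2 · Re · Im`.
Re-pos : ∀ z j → 0ℚ < Im (z ^𝕚 j) → 0ℚ < Im (z ^𝕚 (j ℕ.+ j)) → 0ℚ < Re (z ^𝕚 j)
Re-pos z j 0<I 0<I₂ = 0<*⇒0< (ℚ.<⇒≤ (0<* 0<2 0<I))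
  (subst (0ℚ <_) (trans (cong Im (double z j)) (twice (Re (z ^𝕚 j)) (Im (z ^𝕚 j)))) 0<I₂)
  where
  twice : ∀ a b → a * b + b * a ≡ (1ℚ + 1ℚ) * b * a
  twice = solve-∀ ringℚ

-- The slope of (N + i)ʲ is at least j / N as long as it stays in the first quadrant.
crosses : ∀ N .{{_ : ℕ.NonZero N}} → ¬ (∀ j → j ℕ.< 4 ℕ.* N → 0ℚ < Im ((ι N ,i 1ℚ) ^𝕚 suc j))
crosses N@(suc N′) all = ℚ.<-irrefl refl (ℚ.<-≤-trans 0<R₂ R₂≤0)
  where
  ω = ι N ,i 1ℚ
  im>0 : ∀ j → j ℕ.≤ 4 ℕ.* N → 0ℚ ≤ Im (ω ^𝕚 j)
  im>0 zero    _ = ℚ.≤-refl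
  im>0 (suc j) p = ℚ.<⇒≤ (all j p)
  slope : ∀ j → j ℕ.≤ 4 ℕ.* N → ι j * Re (ω ^𝕚 j) ≤ ι N * Im (ω ^𝕚 j)
  slope zero    _ = ℚ.≤-reflexive (trans (ℚ.*-zeroˡ 1ℚ) (sym (ℚ.*-zeroʳ (ι N))))
  slope (suc j) p = ≤-by (0≤+ (0≤* (0≤ι N) (≤⇒0≤ (slope j (ℕ.<⇒≤ p)))) (0≤* (0≤ι (suc j)) (im>0 j (ℕ.<⇒≤ p))))
                         (cert (ι N) (ι j) (Re (ω ^𝕚 j)) (Im (ω ^𝕚 j)))
    where
    cert : ∀ N j R I → N * (N * I + 1ℚ * R) ≡ (1ℚ + j) * (N * R - 1ℚ * I) + (N * (N * I - j * R) + (1ℚ + j) * I)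
    cert = solve-∀ ringℚ
  N≤2N : N ℕ.≤ N ℕ.+ N
  N≤2N = ℕ.m≤m+n N N
  4N≡ : 4 ℕ.* N ≡ (N ℕ.+ N) ℕ.+ (N ℕ.+ N)
  4N≡ = trans (cong (N ℕ.+_) (trans (cong (N ℕ.+_) (cong (N ℕ.+_) (ℕ.+-identityʳ N))) refl)) (sym (ℕ.+-assoc N N (N ℕ.+ N)))
  2N≤4N : N ℕ.+ N ℕ.≤ 4 ℕ.* N
  2N≤4N = subst (N ℕ.+ N ℕ.≤_) (sym 4N≡) (ℕ.m≤m+n (N ℕ.+ N) (N ℕ.+ N))
  0<I : ∀ j .{{_ : ℕ.NonZero j}} → j ℕ.≤ 4 ℕ.* N → 0ℚ < Im (ω ^𝕚 j)
  0<I (suc j) p = all j p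
  0<R : 0ℚ < Re (ω ^𝕚 N)
  0<R = Re-pos ω N (0<I N (ℕ.≤-trans N≤2N 2N≤4N)) (0<I (N ℕ.+ N) 2N≤4N)
  0<R₂ : 0ℚ < Re (ω ^𝕚 (N ℕ.+ N))
  0<R₂ = Re-pos ω (N ℕ.+ N) (0<I (N ℕ.+ N) 2N≤4N) (0<I ((N ℕ.+ N) ℕ.+ (N ℕ.+ N)) (ℕ.≤-reflexive (sym 4N≡)))
  -- At exponent `N` the slope is at least 1, so the argument is at least `π/4` and squaring gives a
  -- real part `≤ 0`. Positive imaginary parts at exponents `2N` and `4N` force the opposite.
  R≤I : Re (ω ^𝕚 N) ≤ Im (ω ^𝕚 N)
  R≤I = ℚ.*-cancelˡ-≤-pos (ι N) {{ℚ.positive (0<ι N′)}} (slope N (ℕ.≤-trans N≤2N 2N≤4N))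
  R₂≤0 : Re (ω ^𝕚 (N ℕ.+ N)) ≤ 0ℚ
  R₂≤0 = subst (λ z → Re z ≤ 0ℚ) (sym (double ω N))
    (≤-by (≤⇒0≤ (*-mono (ℚ.<⇒≤ 0<R) R≤I (ℚ.<⇒≤ 0<R) R≤I)) (cert (Re (ω ^𝕚 N)) (Im (ω ^𝕚 N))))
    where
    cert : ∀ R I → 0ℚ ≡ R * R - I * I + (I * I - R * R)
    cert = solve-∀ ringℚ

-- `upper` places `arg ζ` strictly between 0 and `π/n`; `left` and `flat` say that `n · arg ζ` falls
-- short of `π` by at most `arctan (1/(2n))`.
record Rotation (n : ℕ) : Set where
  field
    ζ     : ℚ[i]
    upper : ∀ j .{{_ : ℕ.NonZero j}} → j ℕ.≤ n → 0ℚ < Im (ζ ^𝕚 j)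
    left  : Re (ζ ^𝕚 n) < 0ℚ
    flat  : 2ℚ * ι n * Im (ζ ^𝕚 n) ≤ - Re (ζ ^𝕚 n)

-- Let `k + 1` be the first positive exponent at which the power of `ω = N + i` leaves the upper
-- half-plane. Then `ζ = ω^⌊k/n⌋` works: from `ζⁿ` at most `n` more factors `ω` lead across the
-- axis, and they turn by an angle of tangent at most `2n/N`. Taking `N = 4n²` makes this `1/(2n)`.
rotation : ∀ n .{{_ : ℕ.NonZero n}} → Rotation n
rotation n@(suc n′) with first-failure (λ j → 0ℚ ℚ.<? Im ((ι (4 ℕ.* (n ℕ.* n)) ,i 1ℚ) ^𝕚 suc j)) (4 ℕ.* (4 ℕ.* (n ℕ.* n)))
... | inj₁ all             = contradiction all (crosses (4 ℕ.* (n ℕ.* n)))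
... | inj₂ (k , all , ¬p) = record { ζ = ζ ; upper = upper ; left = left ; flat = flat }
  where
  N = 4 ℕ.* (n ℕ.* n)
  ω = ι N ,i 1ℚ
  q = k ℕ./ n
  r = k ℕ.% n
  ζ = ω ^𝕚 q
  2n≤N : 2ℚ * ι n ≤ ι N
  2n≤N = ℚ.≤-trans (ℚ.≤-reflexive (sym (ι-* 2 n)))
           (ι-mono (ℕ.*-mono-≤ {2} {4} (ℕ.s≤s (ℕ.s≤s ℕ.z≤n)) (ℕ.m≤m*n n n)))
  ≤N : ∀ j → j ℕ.≤ n → 2ℚ * ι j ≤ ι N
  ≤N j j≤n = ℚ.≤-trans (*-mono (ℚ.<⇒≤ 0<2) ℚ.≤-refl (0≤ι j) (ι-mono j≤n)) 2n≤N
  0<N : 0ℚ < ι N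
  0<N = ℚ.<-≤-trans (0<* 0<2 (0<ι n′)) 2n≤N
  N1≤N : ι N * 1ℚ ≤ ι N
  N1≤N = ℚ.≤-reflexive (ℚ.*-identityʳ (ι N))
  n≤k : n ℕ.≤ k
  n≤k = ℕ.≮⇒≥ λ k<n → ¬p (small-angle-pos (ι N) ω 0<N 0<1 N1≤N k (≤N (suc k) k<n))
  q-pos : ℕ.NonZero q
  q-pos = ℕ.>-nonZero (ℕ.m≥n⇒m/n>0 n≤k)
  ω-upper : ∀ j .{{_ : ℕ.NonZero j}} → j ℕ.≤ k → 0ℚ < Im (ω ^𝕚 j)
  ω-upper (suc j) j<k = all j j<k
  qn≤k : q ℕ.* n ℕ.≤ k
  qn≤k = ℕ.m/n*n≤m k n
  upper : ∀ j .{{_ : ℕ.NonZero j}} → j ℕ.≤ n → 0ℚ < Im (ζ ^𝕚 j)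
  upper j j≤n = subst (λ z → 0ℚ < Im z) (sym (^-assocʳ ω q j))
    (ω-upper (q ℕ.* j) {{ℕ.m*n≢0 q j {{q-pos}}}} (ℕ.≤-trans (ℕ.*-monoʳ-≤ q j≤n) qn≤k))
  a = Re (ζ ^𝕚 n)
  B = Im (ζ ^𝕚 n)
  sm = small-angle (ι N) ω 0<N 0≤1 N1≤N (suc r) (≤N (suc r) (ℕ.m%n<n k n))
  p = Re (ω ^𝕚 suc r)
  s = Im (ω ^𝕚 suc r)
  0<P : 0ℚ < p
  0<P = proj₁ sm
  0<s : 0ℚ < s
  0<s = small-angle-pos (ι N) ω 0<N 0<1 N1≤N r (≤N (suc r) (ℕ.m%n<n k n))
  0<B : 0ℚ < B
  0<B = upper n ℕ.≤-refl
  product : ω ^𝕚 suc k ≡ ζ ^𝕚 n ⊗ ω ^𝕚 suc r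
  product = trans (cong (ω ^𝕚_) (trans (cong suc (trans (ℕ.m≡m%n+[m/n]*n k n) (ℕ.+-comm r (q ℕ.* n)))) (sym (ℕ.+-suc (q ℕ.* n) r))))
    (trans (^-homo-* ω (q ℕ.* n) (suc r)) (cong (_⊗ ω ^𝕚 suc r) (sym (^-assocʳ ω q n))))
  crossed : a * s + B * p ≤ 0ℚ
  crossed = subst (λ z → Im z ≤ 0ℚ) product (ℚ.≮⇒≥ ¬p)
  0<-a : 0ℚ < - a
  0<-a = 0<*⇒0< (ℚ.<⇒≤ 0<s) (ℚ.<-≤-trans (0<* 0<B 0<P) (≤-by (≤⇒0≤ crossed) (cert a s B p)))
    where
    cert : ∀ a s B p → s * - a ≡ B * p + (0ℚ - (a * s + B * p))
    cert = solve-∀ ringℚ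
  left : a < 0ℚ
  left = <-by 0<-a (sym (ℚ.+-inverseʳ a))
  slope : ι N * B ≤ 2ℚ * ι n * - a
  slope = ℚ.*-cancelʳ-≤-pos p {{ℚ.positive 0<P}} (≤-by
    (0≤+ (0≤+ (0≤* (0≤ι N) (≤⇒0≤ crossed)) (0≤* (ℚ.<⇒≤ 0<-a) (≤⇒0≤ (proj₂ (proj₂ sm)))))
         (0≤* (0≤* (ℚ.<⇒≤ 0<2) (≤⇒0≤ (ι-mono (ℕ.m%n<n k n)))) (0≤* (ℚ.<⇒≤ 0<-a) (ℚ.<⇒≤ 0<P))))
    (cert a s B p (ι N) (ι n) (ι (suc r))))
    where
    cert : ∀ a s B p N n r → (1ℚ + 1ℚ) * n * - a * p ≡ N * B * p +
      (N * (0ℚ - (a * s + B * p)) + - a * ((1ℚ + 1ℚ) * r * p - N * s) + (1ℚ + 1ℚ) * (n - r) * (- a * p))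
    cert = solve-∀ ringℚ
  flat : 2ℚ * ι n * B ≤ - a
  flat = ℚ.*-cancelˡ-≤-pos (2ℚ * ι n) {{ℚ.positive (0<* 0<2 (0<ι n′))}}
    (subst (_≤ 2ℚ * ι n * - a) (trans (cong (_* B) (trans (ι-* 4 (n ℕ.* n)) (cong (ι 4 *_) (ι-* n n)))) (cert (ι n) B)) slope)
    where
    cert : ∀ n B → (1ℚ + (1ℚ + (1ℚ + (1ℚ + 0ℚ)))) * (n * n) * B ≡ (1ℚ + 1ℚ) * n * ((1ℚ + 1ℚ) * n * B)
    cert = solve-∀ ringℚ

-- Lower bounds for powers of 1 + x

4ℚ 5ℚ : ℚ
4ℚ = 2ℚ + 2ℚ
5ℚ = 1ℚ + 4ℚ

0<4 : 0ℚ < 4ℚ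
0<4 = 0<+ 0<2 (ℚ.<⇒≤ 0<2)

^-double : ∀ a m → a ^ (m ℕ.* 2) ≡ a ^ m * a ^ m
^-double a zero    = refl
^-double a (suc m) = trans (cong (λ p → a * (a * p)) (^-double a m)) (regroup a (a ^ m))
  where
  regroup : ∀ a p → a * (a * (p * p)) ≡ a * p * (a * p)
  regroup = solve-∀ ringℚ

0≤m²-m : ∀ m → 0ℚ ≤ ι m * ι m - ι m
0≤m²-m zero    = ℚ.≤-refl
0≤m²-m (suc m) = subst (0ℚ ≤_) (expand (ι m)) (0≤* (0≤ι (suc m)) (0≤ι m))
  where
  expand : ∀ m → (1ℚ + m) * m ≡ (1ℚ + m) * (1ℚ + m) - (1ℚ + m)
  expand = solve-∀ ringℚ

-- The binomial expansion up to the quadratic term, doubled to clear the denominator. The linear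
-- part alone is overtaken by the target `9/4 · y` for large `x`.
bernoulli₂ : ∀ m {x} → 0ℚ ≤ x → 2ℚ + 2ℚ * ι m * x + (ι m * ι m - ι m) * (x * x) ≤ 2ℚ * (1ℚ + x) ^ m
bernoulli₂ zero    {x} _   = ℚ.≤-reflexive (start x)
  where
  start : ∀ x → 2ℚ + 2ℚ * 0ℚ * x + (0ℚ * 0ℚ - 0ℚ) * (x * x) ≡ 2ℚ * 1ℚ
  start = solve-∀ ringℚ
bernoulli₂ (suc m) {x} 0≤x = ≤-by
  (0≤+ (0≤* (0≤+ 0≤1 0≤x) (≤⇒0≤ (bernoulli₂ m 0≤x))) (0≤* (0≤m²-m m) (0≤* 0≤x (0≤a² x))))
  (step (ι m) x ((1ℚ + x) ^ m))
  where
  step : ∀ m x p → (1ℚ + 1ℚ) * ((1ℚ + x) * p) ≡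
    1ℚ + 1ℚ + (1ℚ + 1ℚ) * (1ℚ + m) * x + ((1ℚ + m) * (1ℚ + m) - (1ℚ + m)) * (x * x) +
    ((1ℚ + x) * ((1ℚ + 1ℚ) * p - (1ℚ + 1ℚ + (1ℚ + 1ℚ) * m * x + (m * m - m) * (x * x))) + (m * m - m) * (x * (x * x)))
  step = solve-∀ ringℚ

-- In both certificates below, `4 L - 9 y` with `L` replaced by its quadratic bound has constant
-- term 8. Scaling by `28 = 2 · 14` matches its linear term with that of a square `e²` with constant
-- 14, and `28 · 8 = 14² + 28` leaves 28 over.
8ℚ 9ℚ 28ℚ : ℚ
8ℚ = 4ℚ + 4ℚ
9ℚ = 1ℚ + 8ℚ
28ℚ = 4ℚ * (2ℚ + 5ℚ)

0<28 : 0ℚ < 28ℚ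
0<28 = ℚ.positive⁻¹ 28ℚ

-- because (9/4)² > 5
square-margin : ∀ y L → 0ℚ ≤ y → 9ℚ * y < 4ℚ * L → 5ℚ * (y * y) < L * L
square-margin y L 0≤y 9y<4L = 0<⇒< (0<*⇒0< {4ℚ * 4ℚ} (ℚ.<⇒≤ (0<* 0<4 0<4))
  (subst (0ℚ <_) (cert y L) (0<+ (0<* 0<d (0<+ 0<d (0≤* (0≤+ 0≤9 0≤9) 0≤y))) (0≤a² y))))
  where
  0≤9 : 0ℚ ≤ 9ℚ
  0≤9 = ℚ.nonNegative⁻¹ 9ℚ
  0<d : 0ℚ < 4ℚ * L - 9ℚ * y
  0<d = <⇒0< 9y<4L
  cert : ∀ y L → (4ℚ * L - 9ℚ * y) * (4ℚ * L - 9ℚ * y + (9ℚ + 9ℚ) * y) + y * y ≡ 4ℚ * 4ℚ * (L * L - 5ℚ * (y * y))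
  cert = solve-∀ ringℚ

-- The exponent is `2M`, so the right side is the square of `L = 2 (1 + x)ᴹ` and it is enough to
-- compare `L` with `9/4 · y`.
power-bound-even : ∀ m {x} → 0ℚ ≤ x → let M = 1ℚ + (1ℚ + ι m) ; y = (M + M - 1ℚ) * x in
                   5ℚ * (y * y) < 4ℚ * (1ℚ + x) ^ (suc (suc m) ℕ.* 2)
power-bound-even m {x} 0≤x = ℚ.<-≤-trans (square-margin y L 0≤y 9y<4L)
  (ℚ.≤-reflexive (trans (regroup ((1ℚ + x) ^ suc (suc m))) (cong (4ℚ *_) (sym (^-double (1ℚ + x) (suc (suc m)))))))
  where
  M = 1ℚ + (1ℚ + ι m)
  y = (M + M - 1ℚ) * x
  L = 2ℚ * (1ℚ + x) ^ suc (suc m)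
  regroup : ∀ p → 2ℚ * p * (2ℚ * p) ≡ 4ℚ * (p * p)
  regroup = solve-∀ ringℚ
  odd-factor : ∀ m x → (1ℚ + m + 1ℚ + (1ℚ + m)) * x ≡ ((1ℚ + (1ℚ + m)) + (1ℚ + (1ℚ + m)) - 1ℚ) * x
  odd-factor = solve-∀ ringℚ
  0≤y : 0ℚ ≤ y
  0≤y = subst (0ℚ ≤_) (odd-factor (ι m) x) (0≤* (0≤+ (0≤+ (0≤ι (suc m)) 0≤1) (0≤ι (suc m))) 0≤x)
  -- 4 q(x) - 9 y, with q the bound of bernoulli₂, has negative discriminant for M ≥ 2.
  e = (2ℚ + 4ℚ + 8ℚ) - ((9ℚ + 1ℚ) * M - 9ℚ) * x
  cert : ∀ m x L → 28ℚ * (4ℚ * L - 9ℚ * (((1ℚ + (1ℚ + m)) + (1ℚ + (1ℚ + m)) - 1ℚ) * x)) ≡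
    28ℚ + (((2ℚ + 4ℚ + 8ℚ) - ((9ℚ + 1ℚ) * (1ℚ + (1ℚ + m)) - 9ℚ) * x) * ((2ℚ + 4ℚ + 8ℚ) - ((9ℚ + 1ℚ) * (1ℚ + (1ℚ + m)) - 9ℚ) * x)
    + ((4ℚ + 8ℚ) * (m * m) + (4ℚ * 28ℚ + 4ℚ) * m + (4ℚ * 28ℚ - 9ℚ)) * (x * x)
    + 4ℚ * 28ℚ * (L - (2ℚ + 2ℚ * (1ℚ + (1ℚ + m)) * x + ((1ℚ + (1ℚ + m)) * (1ℚ + (1ℚ + m)) - (1ℚ + (1ℚ + m))) * (x * x))))
  cert = solve-∀ ringℚ
  9y<4L : 9ℚ * y < 4ℚ * L
  9y<4L = 0<⇒< (0<*⇒0< {28ℚ} (ℚ.<⇒≤ 0<28) (subst (0ℚ <_) (sym (cert (ι m) x L))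
    (0<+ 0<28 (0≤+ (0≤+ (0≤a² e)
      (0≤* (0≤+ (0≤+ (0≤* (ℚ.nonNegative⁻¹ (4ℚ + 8ℚ)) (0≤a² (ι m))) (0≤* (ℚ.nonNegative⁻¹ (4ℚ * 28ℚ + 4ℚ)) (0≤ι m)))
                (ℚ.nonNegative⁻¹ (4ℚ * 28ℚ - 9ℚ))) (0≤a² x)))
      (0≤* (ℚ.nonNegative⁻¹ (4ℚ * 28ℚ)) (≤⇒0≤ (bernoulli₂ (suc (suc m)) 0≤x)))))))

-- As (1 + x/2)² ≥ 1 + x, it is enough to bound (1 + x) ^ suc M against M x (1 + x/2).
power-bound-odd : ∀ m {x} → 0ℚ ≤ x → let M = 1ℚ + (1ℚ + ι m) ; y = (M + M) * x in
                  5ℚ * (y * y) < 4ℚ * (1ℚ + x) ^ suc (suc (suc m) ℕ.* 2)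
power-bound-odd m {x} 0≤x = ℚ.*-cancelˡ-<-nonNeg (1ℚ + x) {{ℚ.nonNegative (0≤+ 0≤1 0≤x)}}
  (ℚ.≤-<-trans (≤-by (0≤* (ℚ.nonNegative⁻¹ 5ℚ) (0≤a² (M * x * x))) (dominated M x))
  (ℚ.<-≤-trans (square-margin y L 0≤y 9y<4L)
    (ℚ.≤-reflexive (trans (regroup ((1ℚ + x) ^ suc (suc (suc m)))) (trans (cong (4ℚ *_) (sym (^-double (1ℚ + x) (suc (suc (suc m))))))
      (swap (1ℚ + x) ((1ℚ + x) ^ suc (suc (suc m) ℕ.* 2))))))))
  where
  M = 1ℚ + (1ℚ + ι m)
  y = M * x * (2ℚ + x)
  L = 2ℚ * (1ℚ + x) ^ suc (suc (suc m))
  dominated : ∀ M x → 5ℚ * (M * x * (2ℚ + x) * (M * x * (2ℚ + x))) ≡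
                 (1ℚ + x) * (5ℚ * ((M + M) * x * ((M + M) * x))) + 5ℚ * (M * x * x * (M * x * x))
  dominated = solve-∀ ringℚ
  swap : ∀ a p → 4ℚ * (a * p) ≡ a * (4ℚ * p)
  swap = solve-∀ ringℚ
  regroup : ∀ p → 2ℚ * p * (2ℚ * p) ≡ 4ℚ * (p * p)
  regroup = solve-∀ ringℚ
  0≤y : 0ℚ ≤ y
  0≤y = 0≤* (0≤* (0≤ι (suc (suc m))) 0≤x) (0≤+ (ℚ.<⇒≤ 0<2) 0≤x)
  e = (2ℚ + 4ℚ + 8ℚ) - ((9ℚ + 1ℚ) * M - 8ℚ) * x
  cert : ∀ m x L → 28ℚ * (4ℚ * L - 9ℚ * ((1ℚ + (1ℚ + m)) * x * (2ℚ + x))) ≡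
    28ℚ + (((2ℚ + 4ℚ + 8ℚ) - ((9ℚ + 1ℚ) * (1ℚ + (1ℚ + m)) - 8ℚ) * x) * ((2ℚ + 4ℚ + 8ℚ) - ((9ℚ + 1ℚ) * (1ℚ + (1ℚ + m)) - 8ℚ) * x)
    + ((4ℚ + 8ℚ) * (m * m) + (4ℚ + 8ℚ * 8ℚ) * m + (8ℚ + 8ℚ + 8ℚ)) * (x * x)
    + 4ℚ * 28ℚ * (L - (2ℚ + 2ℚ * (1ℚ + (1ℚ + (1ℚ + m))) * x + ((1ℚ + (1ℚ + (1ℚ + m))) * (1ℚ + (1ℚ + (1ℚ + m))) - (1ℚ + (1ℚ + (1ℚ + m)))) * (x * x))))
  cert = solve-∀ ringℚ
  9y<4L : 9ℚ * y < 4ℚ * L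
  9y<4L = 0<⇒< (0<*⇒0< {28ℚ} (ℚ.<⇒≤ 0<28) (subst (0ℚ <_) (sym (cert (ι m) x L))
    (0<+ 0<28 (0≤+ (0≤+ (0≤a² e)
      (0≤* (0≤+ (0≤+ (0≤* (ℚ.nonNegative⁻¹ (4ℚ + 8ℚ)) (0≤a² (ι m))) (0≤* (ℚ.nonNegative⁻¹ (4ℚ + 8ℚ * 8ℚ)) (0≤ι m)))
                (ℚ.nonNegative⁻¹ (8ℚ + 8ℚ + 8ℚ))) (0≤a² x)))
      (0≤* (ℚ.nonNegative⁻¹ (4ℚ * 28ℚ)) (≤⇒0≤ (bernoulli₂ (suc (suc (suc m))) 0≤x)))))))

-- This would be `M = 1` in the odd case, where the coefficient `12 M² + 20 M - 64` left for `x²` is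
-- negative; hence a separate certificate.
power-bound₃ : ∀ {x} → 0ℚ ≤ x → 5ℚ * (2ℚ * x * (2ℚ * x)) < 4ℚ * (1ℚ + x) ^ 3
power-bound₃ {x} 0≤x = <-by (0<+ 0<4 (0≤+ (0≤* (ℚ.<⇒≤ (0<+ 0<4 (ℚ.<⇒≤ 0<4))) 0≤x) (0≤* (0≤* (ℚ.<⇒≤ 0<4) 0≤x) (0≤a² (x - 1ℚ))))) (cert x)
  where
  cert : ∀ x → 4ℚ * ((1ℚ + x) * ((1ℚ + x) * ((1ℚ + x) * 1ℚ))) ≡
    5ℚ * (2ℚ * x * (2ℚ * x)) + (4ℚ + (8ℚ * x + 4ℚ * x * ((x - 1ℚ) * (x - 1ℚ))))
  cert = solve-∀ ringℚ

data Parity : ℕ → Set where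
  even : ∀ m → Parity (m ℕ.* 2)
  odd  : ∀ m → Parity (suc (m ℕ.* 2))

parity : ∀ n → Parity n
parity zero = even 0
parity (suc n) with parity n
... | even m = odd m
... | odd m  = even (suc m)

ι-double : ∀ m → ι (m ℕ.* 2) ≡ ι m + ι m
ι-double m = trans (ι-* m 2) (twice (ι m))
  where
  twice : ∀ a → a * (1ℚ + (1ℚ + 0ℚ)) ≡ a + a
  twice = solve-∀ ringℚ

-- `4/5` is the squared cosine of the angle with tangent `1/2`, the deviation from the real axis
-- tolerated at the nodes. At `N = 1` the inequality fails for large `x`.
power-bound : ∀ N {x} → 2 ℕ.≤ N → 0ℚ ≤ x → 5ℚ * (ι N * x * (ι N * x)) < 4ℚ * (1ℚ + x) ^ suc N
power-bound N {x} 2≤N 0≤x with parity N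
... | even (suc zero)    = power-bound₃ 0≤x
... | even (suc (suc m)) = subst (λ a → 5ℚ * (a * x * (a * x)) < 4ℚ * (1ℚ + x) ^ suc (suc (suc m) ℕ.* 2)) (sym (ι-double (suc (suc m)))) (power-bound-odd m 0≤x)
... | odd (suc m)        = subst (λ a → 5ℚ * (a * x * (a * x)) < 4ℚ * (1ℚ + x) ^ (suc (suc m) ℕ.* 2))
  (trans (pred (ι m)) (cong (1ℚ +_) (sym (ι-double (suc m))))) (power-bound-even m 0≤x)
  where
  pred : ∀ m → 1ℚ + (1ℚ + m) + (1ℚ + (1ℚ + m)) - 1ℚ ≡ 1ℚ + (1ℚ + m + (1ℚ + m))
  pred = solve-∀ ringℚ
power-bound N {x} (ℕ.s≤s ()) 0≤x | odd zero

-- The polynomials E n - (n - 1) t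

-- The recursion is multiplication by `1 + √t`: `E n + √t · O n = (1 + √t)ⁿ`, so
-- `O n = Σⱼ C(n, 2j + 1) tʲ`.
E O : ℕ → ℚ[i] → ℚ[i]
E zero    w = 1𝕚
E (suc n) w = E n w ⊕ w ⊗ O n w
O zero    w = 0𝕚
O (suc n) w = E n w ⊕ O n w

P : ℕ → ℚ[i] → ℚ[i]
P N w = E (suc N) w ⊕ ⊝ (ofℚ (ι N)) ⊗ w

e o : ℕ → ℚ → ℚ
e zero    t = 1ℚ
e (suc n) t = e n t + t * o n t
o zero    t = 0ℚ
o (suc n) t = e n t + o n t

ofℚ-⊗ : ∀ a b → ofℚ a ⊗ ofℚ b ≡ ofℚ (a * b)
ofℚ-⊗ a b = cong₂ _,i_ (real a b) (imag a b)
  where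
  real : ∀ a b → a * b - 0ℚ * 0ℚ ≡ a * b
  real = solve-∀ ringℚ
  imag : ∀ a b → a * 0ℚ + 0ℚ * b ≡ 0ℚ
  imag = solve-∀ ringℚ

E-real : ∀ n t → E n (ofℚ t) ≡ ofℚ (e n t)
O-real : ∀ n t → O n (ofℚ t) ≡ ofℚ (o n t)
E-real zero    t = refl
E-real (suc n) t = trans (cong₂ (λ a b → a ⊕ ofℚ t ⊗ b) (E-real n t) (O-real n t))
                         (cong (ofℚ (e n t) ⊕_) (ofℚ-⊗ t (o n t)))
O-real zero    t = refl
O-real (suc n) t = cong₂ _⊕_ (E-real n t) (O-real n t)

P-real : ∀ N t → P N (ofℚ t) ≡ ofℚ (e (suc N) t - ι N * t)
P-real N t = trans (cong₂ _⊕_ (E-real (suc N) t) (ofℚ-⊗ (- ι N) t)) (cong ofℚ (sign (e (suc N) t) (ι N) t))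
  where
  sign : ∀ a b c → a + - b * c ≡ a - b * c
  sign = solve-∀ ringℚ

-- Degree bounds for `E`, `O` and `P`

deg-0 : ∀ k → Deg< k (λ _ → 0𝕚)
deg-0 zero    = λ _ → refl
deg-0 (suc k) = 0𝕚 , (λ _ → 0𝕚) , deg-0 k , zeroes
  where
  zeroes : ∀ w → 0𝕚 ≡ 0𝕚 ⊕ w ⊗ 0𝕚
  zeroes = solve-∀ ring𝕚

deg-const : ∀ k c → Deg< (suc k) (λ _ → c)
deg-const k c = c , (λ _ → 0𝕚) , deg-0 k , absorb c
  where
  absorb : ∀ c w → c ≡ c ⊕ w ⊗ 0𝕚
  absorb = solve-∀ ring𝕚

deg-id : ∀ k → Deg< (suc (suc k)) (λ w → w)
deg-id k = deg-cong (suc (suc k)) unit (deg-t* (suc k) (deg-const k 1𝕚))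
  where
  unit : ∀ w → w ≡ w ⊗ 1𝕚
  unit = solve-∀ ring𝕚

deg-⊕ : ∀ k {f g} → Deg< k f → Deg< k g → Deg< k (λ w → f w ⊕ g w)
deg-⊕ k {f} {g} df dg = deg-cong k (λ w → unit (f w) (g w)) (deg-+ k 1𝕚 df dg)
  where
  unit : ∀ a b → a ⊕ b ≡ a ⊕ 1𝕚 ⊗ b
  unit = solve-∀ ring𝕚

deg-E-O : ∀ m → Deg< (suc m) (E (m ℕ.* 2)) × Deg< m (O (m ℕ.* 2))
deg-E-O zero    = deg-const 0 1𝕚 , λ _ → refl
deg-E-O (suc m) =
  let dE , dO = deg-E-O m
      dE₁ = deg-⊕ (suc m) dE (deg-t* m dO)
      dO₁ = deg-⊕ (suc m) dE (deg-suc m dO)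
  in deg-⊕ (suc (suc m)) (deg-suc (suc m) dE₁) (deg-t* (suc m) dO₁) , deg-⊕ (suc m) dE₁ dO₁

deg-P : ∀ N → 2 ℕ.≤ N → Σ ℕ λ d → Deg< (suc d) (P N) × d ℕ.* 2 ℕ.≤ suc N
deg-P N 2≤N with parity N
... | even (suc m) = suc m
  , deg-+ (suc (suc m)) (⊝ (ofℚ (ι (suc m ℕ.* 2))))
      (deg-⊕ (suc (suc m)) (proj₁ (deg-E-O (suc m))) (deg-t* (suc m) (proj₂ (deg-E-O (suc m))))) (deg-id m)
  , ℕ.n≤1+n _
... | odd m        = suc m
  , deg-+ (suc (suc m)) (⊝ (ofℚ (ι (suc (m ℕ.* 2))))) (proj₁ (deg-E-O (suc m))) (deg-id m)
  , ℕ.≤-refl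

-- With r + i s = r (1 + i u) and t = - u², this is (1 + i u)ⁿ = E n t + i u O n t.
polar : ∀ n {r s u} → r * u ≡ s →
        (r ,i s) ^𝕚 n ≡ (r ^ n * e n (- (u * u)) ,i r ^ n * (u * o n (- (u * u))))
polar zero    {u = u} _ = cong₂ _,i_ refl (zeroes u)
  where
  zeroes : ∀ u → 0ℚ ≡ 1ℚ * (u * 0ℚ)
  zeroes = solve-∀ ringℚ
polar (suc n) {r} {u = u} refl = trans (cong ((r ,i r * u) ⊗_) (polar n refl))
  (cong₂ _,i_ (real r u (r ^ n) (e n (- (u * u))) (o n (- (u * u))))
              (imag r u (r ^ n) (e n (- (u * u))) (o n (- (u * u)))))
  where
  real : ∀ r u p e o → r * (p * e) - r * u * (p * (u * o)) ≡ r * p * (e + - (u * u) * o)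
  real = solve-∀ ringℚ
  imag : ∀ r u p e o → r * (p * (u * o)) + r * u * (p * e) ≡ r * p * (u * (e + o))
  imag = solve-∀ ringℚ

norm-^ : ∀ z n → norm (z ^𝕚 n) ≡ norm z ^ n
norm-^ z zero    = refl
norm-^ z (suc n) = trans (multiplicative (Re z) (Im z) (Re (z ^𝕚 n)) (Im (z ^𝕚 n))) (cong (norm z *_) (norm-^ z n))
  where
  multiplicative : ∀ a b c d → (a * c - b * d) * (a * c - b * d) + (a * d + b * c) * (a * d + b * c) ≡
                               (a * a + b * b) * (c * c + d * d)
  multiplicative = solve-∀ ringℚ

norm-polar : ∀ n {r s u} → r * u ≡ s → norm ((r ,i s) ^𝕚 n) ≡ r ^ n * r ^ n * (1ℚ + u * u) ^ n
norm-polar n {r} {u = u} refl = trans (norm-^ (r ,i r * u) n)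
  (trans (cong (_^ n) (split r u)) (trans (^-distrib-* (r * r) (1ℚ + u * u) n)
         (cong (_* (1ℚ + u * u) ^ n) (^-distrib-* r r n))))
  where
  split : ∀ r u → r * r + r * u * (r * u) ≡ r * r * (1ℚ + u * u)
  split = solve-∀ ringℚ

^-comm : ∀ z m n → (z ^𝕚 m) ^𝕚 n ≡ (z ^𝕚 n) ^𝕚 m
^-comm z m n = trans (^-assocʳ z m n) (trans (cong (z ^𝕚_) (ℕ.*-comm m n)) (sym (^-assocʳ z n m)))

-- The base is minus the conjugate of `γ`, and conjugation commutes with powers.
reflect-^ : ∀ γ j → (- Re γ ,i Im γ) ^𝕚 j ≡ (sg j * Re (γ ^𝕚 j) ,i - sg j * Im (γ ^𝕚 j))
reflect-^ γ zero    = cong₂ _,i_ refl refl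
reflect-^ γ (suc j) = trans (cong ((- Re γ ,i Im γ) ⊗_) (reflect-^ γ j))
  (cong₂ _,i_ (real (Re γ) (Im γ) (sg j) (Re (γ ^𝕚 j)) (Im (γ ^𝕚 j)))
              (imag (Re γ) (Im γ) (sg j) (Re (γ ^𝕚 j)) (Im (γ ^𝕚 j))))
  where
  real : ∀ a b s c d → - a * (s * c) - b * (- s * d) ≡ - s * (a * c - b * d)
  real = solve-∀ ringℚ
  imag : ∀ a b s c d → - a * (- s * d) + b * (s * c) ≡ - - s * (a * d + b * c)
  imag = solve-∀ ringℚ

sg-cases : ∀ j → sg j ≡ 1ℚ ⊎ sg j ≡ - 1ℚ
sg-cases zero    = inj₁ refl
sg-cases (suc j) with sg-cases j
... | inj₁ p = inj₂ (cong -_ p)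
... | inj₂ p = inj₁ (trans (cong -_ p) refl)

0<R+sg*W : ∀ j {R W} → 0ℚ ≤ W → W < R → 0ℚ < R + sg j * W
0<R+sg*W j {R} {W} 0≤W W<R with sg-cases j
... | inj₁ p = subst (λ s → 0ℚ < R + s * W) (sym p) (0<+ (ℚ.≤-<-trans 0≤W W<R) (0≤* 0≤1 0≤W))
... | inj₂ p = subst (λ s → 0ℚ < R + s * W) (sym p) (subst (0ℚ <_) (minus R W) (<⇒0< W<R))
  where
  minus : ∀ R W → R - W ≡ R + - 1ℚ * W
  minus = solve-∀ ringℚ

-- The default 0 makes the nodes total in their index and keeps `recip` nonnegative for every `r`.
-- Only indices with `2j ≤ n`, where `r j` is positive, serve as nodes of `P`.
recip : ℚ → ℚ
recip r with 0ℚ ℚ.<? r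
... | yes p = proj₁ (inverse p)
... | no  _ = 0ℚ

recip-inverse : ∀ {r} → 0ℚ < r → r * recip r ≡ 1ℚ
recip-inverse {r} 0<r with 0ℚ ℚ.<? r
... | yes p = proj₂ (proj₂ (inverse p))
... | no ¬p = contradiction 0<r ¬p

recip-nonNeg : ∀ r → 0ℚ ≤ recip r
recip-nonNeg r with 0ℚ ℚ.<? r
... | yes p = ℚ.<⇒≤ (proj₁ (proj₂ (inverse p)))
... | no  _ = ℚ.≤-refl

-- The nodes are t = - tan² (j θ), where θ = arg ζ is close to π / n.
module Alternation (N : ℕ) (2≤N : 2 ℕ.≤ N) (rot : Rotation (suc N)) where
  open Rotation rot

  n = suc N

  r s u : ℕ → ℚ
  r j = Re (ζ ^𝕚 j)
  s j = Im (ζ ^𝕚 j)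
  u j = s j * recip (r j)

  node : ℕ → ℚ
  node j = - (u j * u j)

  private
    half : ∀ {j} → j ℕ.* 2 ℕ.≤ n → j ℕ.+ j ℕ.≤ n
    half {j} = subst (ℕ._≤ n) (trans (ℕ.*-comm j 2) (cong (j ℕ.+_) (ℕ.+-identityʳ j)))

  0<r : ∀ j → j ℕ.* 2 ℕ.≤ n → 0ℚ < r j
  0<r zero      _ = 0<1
  0<r j@(suc _) p = Re-pos ζ j (upper j (ℕ.≤-trans (ℕ.m≤m+n j j) (half p))) (upper (j ℕ.+ j) (half p))

  0≤s : ∀ j → j ℕ.* 2 ℕ.≤ n → 0ℚ ≤ s j
  0≤s zero      _ = ℚ.≤-refl
  0≤s j@(suc _) p = ℚ.<⇒≤ (upper j (ℕ.≤-trans (ℕ.m≤m+n j j) (half p)))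

  0≤u : ∀ j → j ℕ.* 2 ℕ.≤ n → 0ℚ ≤ u j
  0≤u j p = 0≤* (0≤s j p) (recip-nonNeg (r j))

  ru≡s : ∀ j → j ℕ.* 2 ℕ.≤ n → r j * u j ≡ s j
  ru≡s j p = trans (swap (r j) (s j) (recip (r j))) (trans (cong (s j *_) (recip-inverse (0<r j p))) (ℚ.*-identityʳ (s j)))
    where
    swap : ∀ r s q → r * (s * q) ≡ s * (r * q)
    swap = solve-∀ ringℚ

  -- `u j` is `tan (jθ)`. Cleared of denominators, the difference is `Im (conj (ζ^j) · ζ^(j+1)) = Im
  -- ζ · |ζ^j|²`.
  u-step : ∀ j → suc j ℕ.* 2 ℕ.≤ n → u j < u (suc j)
  u-step j p = 0<⇒< (0<*⇒0< (ℚ.<⇒≤ (0<* (0<r j q) (0<r (suc j) p)))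
    (subst (0ℚ <_) (sym slope) (0<* 0<v (0<+ (0<* (0<r j q) (0<r j q)) (0≤a² (s j))))))
    where
    q : j ℕ.* 2 ℕ.≤ n
    q = ℕ.≤-trans (ℕ.m≤n+m (j ℕ.* 2) 2) p
    0<v : 0ℚ < Im ζ
    0<v = subst (0ℚ <_) (unit (Re ζ) (Im ζ)) (upper 1 (ℕ.s≤s ℕ.z≤n))
      where
      unit : ∀ a b → a * 0ℚ + b * 1ℚ ≡ b
      unit = solve-∀ ringℚ
    expand : ∀ a b x y → a * b * (y - x) ≡ a * (b * y) - b * (a * x)
    expand = solve-∀ ringℚ
    area : ∀ p v r s → r * (p * s + v * r) - (p * r - v * s) * s ≡ v * (r * r + s * s)
    area = solve-∀ ringℚ
    slope : r j * r (suc j) * (u (suc j) - u j) ≡ Im ζ * (r j * r j + s j * s j)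
    slope = trans (expand (r j) (r (suc j)) (u j) (u (suc j)))
      (trans (cong₂ (λ a b → r j * a - r (suc j) * b) (ru≡s (suc j) p) (ru≡s j q)) (area (Re ζ) (Im ζ) (r j) (s j)))

  u-mono : ∀ i j → i ℕ.< j → j ℕ.* 2 ℕ.≤ n → u i < u j
  u-mono i (suc j) (ℕ.s≤s i≤j) p with ℕ.m≤n⇒m<n∨m≡n i≤j
  ... | inj₂ refl = u-step j p
  ... | inj₁ i<j  = ℚ.<-trans (u-mono i j i<j (ℕ.≤-trans (ℕ.m≤n+m (j ℕ.* 2) 2) p)) (u-step j p)

  decreasing : ∀ d → d ℕ.* 2 ℕ.≤ n → Nodes.Decreasing node (suc d)
  decreasing d p i j i<j j<d+1 = <-by (0<* 0<d (0<+ 0<d (0≤+ (0≤u i pᵢ) (0≤u i pᵢ)))) (cert (u i) (u j))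
    where
    pⱼ : j ℕ.* 2 ℕ.≤ n
    pⱼ = ℕ.≤-trans (ℕ.*-monoˡ-≤ 2 (ℕ.s≤s⁻¹ j<d+1)) p
    pᵢ : i ℕ.* 2 ℕ.≤ n
    pᵢ = ℕ.≤-trans (ℕ.*-monoˡ-≤ 2 (ℕ.<⇒≤ i<j)) pⱼ
    0<d : 0ℚ < u j - u i
    0<d = <⇒0< (u-mono i j i<j pⱼ)
    cert : ∀ a b → - (a * a) ≡ - (b * b) + (b - a) * (b - a + (a + a))
    cert = solve-∀ ringℚ

  -- Minus the conjugate of `ζⁿ`. Its argument `π - nθ` is small and positive, so `small-angle`
  -- applies to its powers.
  γ : ℚ[i]
  γ = - Re (ζ ^𝕚 n) ,i Im (ζ ^𝕚 n)

  ζʲⁿ : ∀ j → (ζ ^𝕚 j) ^𝕚 n ≡ (sg j * Re (γ ^𝕚 j) ,i - sg j * Im (γ ^𝕚 j))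
  ζʲⁿ j = trans (^-comm ζ j n) (trans (cong (_^𝕚 j) (cong₂ _,i_ (neg-neg (Re (ζ ^𝕚 n))) refl)) (reflect-^ γ j))
    where
    neg-neg : ∀ a → a ≡ - - a
    neg-neg = solve-∀ ringℚ

  -- Scaled by `rⁿ > 0` and by the expected sign, `P` at the node becomes `R + (-1)ʲ W`, with `R`
  -- from `E n` and `W` from the subtracted linear term. So `W < R` suffices for either parity of
  -- `j`.
  alternates : ∀ d → d ℕ.* 2 ℕ.≤ n → Nodes.Alternates node (suc d) (P N)
  alternates d p j j<d+1 = e n t - ι N * t , P-real N t , 0<*⇒0< (ℚ.<⇒≤ 0<rⁿ) (subst (0ℚ <_) (sym value) (0<R+sg*W j 0≤W W<R))
    where
    q : j ℕ.* 2 ℕ.≤ n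
    q = ℕ.≤-trans (ℕ.*-monoˡ-≤ 2 (ℕ.s≤s⁻¹ j<d+1)) p
    t = node j
    x = u j * u j
    rⁿ = r j ^ n
    0<rⁿ : 0ℚ < rⁿ
    0<rⁿ = ^-pos n (0<r j q)
    R = Re (γ ^𝕚 j)
    I = Im (γ ^𝕚 j)
    W = ι N * x * rⁿ
    0≤W : 0ℚ ≤ W
    0≤W = 0≤* (0≤* (0≤ι N) (0≤a² (u j))) (ℚ.<⇒≤ 0<rⁿ)
    2j≤n : 2ℚ * ι j ≤ ι n
    2j≤n = ℚ.≤-trans (ℚ.≤-reflexive (trans (sym (ι-* 2 j)) (cong ι (ℕ.*-comm 2 j)))) (ι-mono q)
    n≤2n : ι n ≤ 2ℚ * ι n
    n≤2n = ≤-by (0≤ι n) (twice (ι n))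
      where
      twice : ∀ a → (1ℚ + 1ℚ) * a ≡ a + a
      twice = solve-∀ ringℚ
    0<-a : 0ℚ < - Re (ζ ^𝕚 n)
    0<-a = ℚ.neg-antimono-< left
    sm = small-angle (2ℚ * ι n) γ 0<-a (ℚ.<⇒≤ (upper n ℕ.≤-refl)) flat j (ℚ.≤-trans 2j≤n n≤2n)
    -- `γʲ` has slope at most `2j / (2n)`, and `2j ≤ n`.
    2I≤R : 2ℚ * I ≤ R
    2I≤R = ℚ.*-cancelˡ-≤-pos (ι n) {{ℚ.positive (0<ι N)}}
      (ℚ.≤-trans (ℚ.≤-reflexive (swap (ι n) I)) (ℚ.≤-trans (proj₂ (proj₂ sm))
        (*-mono (0≤* (ℚ.<⇒≤ 0<2) (0≤ι j)) 2j≤n (ℚ.<⇒≤ (proj₁ sm)) ℚ.≤-refl)))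
      where
      swap : ∀ n I → n * ((1ℚ + 1ℚ) * I) ≡ (1ℚ + 1ℚ) * n * I
      swap = solve-∀ ringℚ
    -- `5 W² < 4 (R² + I²) ≤ 5 R²`, first by `power-bound`, then by `2 I ≤ R`.
    W<R : W < R
    W<R = a²<b²⇒a<b (ℚ.<⇒≤ (proj₁ sm)) (ℚ.*-cancelˡ-<-nonNeg 5ℚ (ℚ.<-≤-trans
      (ℚ.<-≤-trans (0<⇒< (subst (0ℚ <_) (scale (ι N * x) ((1ℚ + x) ^ n) rⁿ) (0<* (0<* 0<rⁿ 0<rⁿ) (<⇒0< (power-bound N 2≤N (0≤a² (u j)))))))
        (ℚ.≤-reflexive (cong (4ℚ *_) norms)))
      (≤-by (≤⇒0≤ (*-mono (0≤* (ℚ.<⇒≤ 0<2) (proj₁ (proj₂ sm))) 2I≤R (0≤* (ℚ.<⇒≤ 0<2) (proj₁ (proj₂ sm))) 2I≤R)) (cert R I))))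
      where
      scale : ∀ a b c → c * c * (4ℚ * b - 5ℚ * (a * a)) ≡ 4ℚ * (c * c * b) - 5ℚ * (a * c * (a * c))
      scale = solve-∀ ringℚ
      cert : ∀ R I → 5ℚ * (R * R) ≡ 4ℚ * (R * R + I * I) + (R * R - 2ℚ * I * (2ℚ * I))
      cert = solve-∀ ringℚ
      signs : ∀ g R I → g * R * (g * R) + - g * I * (- g * I) ≡ g * g * (R * R + I * I)
      signs = solve-∀ ringℚ
      norms : rⁿ * rⁿ * (1ℚ + x) ^ n ≡ R * R + I * I
      norms = begin
        rⁿ * rⁿ * (1ℚ + x) ^ n               ≡⟨ norm-polar n {r j} {s j} {u j} (ru≡s j q) ⟨
        norm ((ζ ^𝕚 j) ^𝕚 n)                 ≡⟨ cong norm (ζʲⁿ j) ⟩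
        norm (sg j * R ,i - sg j * I)        ≡⟨ signs (sg j) R I ⟩
        sg j * sg j * (R * R + I * I)        ≡⟨ cong (_* (R * R + I * I)) (sg² j) ⟩
        1ℚ * (R * R + I * I)                 ≡⟨ ℚ.*-identityˡ (R * R + I * I) ⟩
        R * R + I * I                        ∎
        where open ≡-Reasoning
    value : rⁿ * (sg j * (e n t - ι N * t)) ≡ R + sg j * W
    value = begin
      rⁿ * (sg j * (e n t - ι N * t))          ≡⟨ expand rⁿ (sg j) (e n t) (ι N) x ⟩
      sg j * (rⁿ * e n t) + sg j * W           ≡⟨ cong (λ z → sg j * z + sg j * W) (cong Re (trans (sym (polar n {r j} {s j} {u j} (ru≡s j q))) (ζʲⁿ j))) ⟩
      sg j * (sg j * R) + sg j * W             ≡⟨ cong (_+ sg j * W) (trans (sym (ℚ.*-assoc (sg j) (sg j) R)) (trans (cong (_* R) (sg² j)) (ℚ.*-identityˡ R))) ⟩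
      R + sg j * W                             ∎
      where
      open ≡-Reasoning
      expand : ∀ p g e N x → p * (g * (e - N * - x)) ≡ g * (p * e) + g * (N * x * p)
      expand = solve-∀ ringℚ

record Alternating (N : ℕ) : Set where
  field
    d          : ℕ
    node       : ℕ → ℚ
    degree     : Deg< (suc d) (P N)
    decreasing : Nodes.Decreasing node (suc d)
    alternates : Nodes.Alternates node (suc d) (P N)

-- This covers `n = 1` and `n = 2`, where `E 1 = 1` and `E 2 - t = 1`. Degree 0 asks for a single
-- node, and any would do.
P-constant : ∀ N → (∀ w → P N w ≡ 1𝕚) → Alternating N
P-constant N h = record
  { d          = 0
  ; node       = λ _ → 0ℚ
  ; degree     = deg-cong 1 h (deg-const 0 1𝕚)
  ; decreasing = λ { _ (suc _) _ (ℕ.s≤s ()) }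
  ; alternates = λ { zero _ → 1ℚ , h (ofℚ 0ℚ) , 0<1 ; (suc _) (ℕ.s≤s ()) }
  }

P-alternating : ∀ N → Alternating N
P-alternating zero = P-constant 0 lem
  where
  lem : ∀ w → 1𝕚 ⊕ w ⊗ 0𝕚 ⊕ ⊝ 0𝕚 ⊗ w ≡ 1𝕚
  lem = solve-∀ ring𝕚
P-alternating (suc zero) = P-constant 1 lem
  where
  lem : ∀ w → 1𝕚 ⊕ w ⊗ 0𝕚 ⊕ w ⊗ (1𝕚 ⊕ 0𝕚) ⊕ ⊝ 1𝕚 ⊗ w ≡ 1𝕚
  lem = solve-∀ ring𝕚
P-alternating N@(suc (suc _)) =
  let 2≤N = ℕ.s≤s (ℕ.s≤s ℕ.z≤n)
      d , degree , d*2≤n = deg-P N 2≤N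
      module A = Alternation N 2≤N (rotation (suc N))
  in record
    { d          = d
    ; node       = A.node
    ; degree     = degree
    ; decreasing = A.decreasing d d*2≤n
    ; alternates = A.alternates d d*2≤n
    }

-- Connected Abelian area sequences

unique-↭ : ∀ {A : Set} {xs ys : List A} → Unique xs → Unique ys →
           (∀ {x} → x ∈ xs → x ∈ ys) → (∀ {x} → x ∈ ys → x ∈ xs) → xs ↭ ys
unique-↭ u v f g = ∼bag⇒↭ (unique∧set⇒bag u v (mk⇔ f g))

-- With 0-based positions, a connected Abelian area sequence is 0, 1, …, k - 1
-- followed by entries i + gᵢ (i = 0, 1, …), where g₀, g₁, … is weakly
-- decreasing and 1 ≤ g₀ ≤ k - 1.  After an entry s + g, `tails s g r` lists the
-- r remaining ones; after an initial run up to x, `runs x r` does.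
tails : ℕ → ℕ → (r : ℕ) → List (Vec ℕ r)
drops : ℕ → ℕ → (r : ℕ) → List (Vec ℕ (suc r))
tails s g zero    = [] ∷ []
tails s g (suc r) = drops (suc s) (suc g) r
drops s zero    r = []
drops s (suc g) r = map (s ℕ.+ g ∷_) (tails s g r) ++ drops s g r

firsts : ℕ → (r : ℕ) → List (Vec ℕ (suc r))
firsts zero    r = []
firsts (suc x) r = map (suc x ∷_) (tails 0 (suc x) r) ++ firsts x r

runs : ℕ → (r : ℕ) → List (Vec ℕ r)
runs x zero    = [] ∷ []
runs x (suc r) = map (suc x ∷_) (runs (suc x) r) ++ firsts x r

∈-map∷⁻ : ∀ {x y r} {v : Vec ℕ r} {vs} → y ∷ v ∈ map (x ∷_) vs → y ≡ x × v ∈ vs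
∈-map∷⁻ p with ∈-map⁻ _ p
... | _ , q , refl = refl , q

∈-drops⁺ : ∀ s g g′ {r} {v : Vec ℕ r} → g′ ℕ.< g → v ∈ tails s g′ r → s ℕ.+ g′ ∷ v ∈ drops s g r
∈-drops⁺ s (suc g) g′ {r} (ℕ.s≤s g′≤g) p with ℕ.m≤n⇒m<n∨m≡n g′≤g
... | inj₁ g′<g = ∈-++⁺ʳ (map (s ℕ.+ g ∷_) (tails s g r)) (∈-drops⁺ s g g′ g′<g p)
... | inj₂ refl = ∈-++⁺ˡ (∈-map⁺ (s ℕ.+ g′ ∷_) p)

∈-drops⁻ : ∀ s g {r y} {v : Vec ℕ r} → y ∷ v ∈ drops s g r →
           Σ ℕ λ g′ → g′ ℕ.< g × y ≡ s ℕ.+ g′ × v ∈ tails s g′ r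
∈-drops⁻ s (suc g) {r} p with ∈-++⁻ (map (s ℕ.+ g ∷_) (tails s g r)) p
... | inj₁ q = let e , t = ∈-map∷⁻ q in g , ℕ.≤-refl , e , t
... | inj₂ q = let g′ , l , e , t = ∈-drops⁻ s g q in g′ , ℕ.m≤n⇒m≤1+n l , e , t

∈-firsts⁺ : ∀ x y {r} {v : Vec ℕ r} → 1 ℕ.≤ y → y ℕ.≤ x → v ∈ tails 0 y r → y ∷ v ∈ firsts x r
∈-firsts⁺ (suc x) y {r} 1≤y y≤x p with ℕ.m≤n⇒m<n∨m≡n y≤x
... | inj₁ y<x  = ∈-++⁺ʳ (map (suc x ∷_) (tails 0 (suc x) r)) (∈-firsts⁺ x y 1≤y (ℕ.s≤s⁻¹ y<x) p)
... | inj₂ refl = ∈-++⁺ˡ (∈-map⁺ (y ∷_) p)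
∈-firsts⁺ zero _ (ℕ.s≤s _) () _

∈-firsts⁻ : ∀ x {r y} {v : Vec ℕ r} → y ∷ v ∈ firsts x r → 1 ℕ.≤ y × y ℕ.≤ x × v ∈ tails 0 y r
∈-firsts⁻ (suc x) {r} p with ∈-++⁻ (map (suc x ∷_) (tails 0 (suc x) r)) p
... | inj₂ q = let 1≤y , y≤x , t = ∈-firsts⁻ x q in 1≤y , ℕ.m≤n⇒m≤1+n y≤x , t
... | inj₁ q with ∈-map∷⁻ q
...   | refl , t = ℕ.s≤s ℕ.z≤n , ℕ.≤-refl , t

∈-runs⁻ : ∀ x {r y} {v : Vec ℕ r} → y ∷ v ∈ runs x (suc r) →
          (y ≡ suc x × v ∈ runs (suc x) r) ⊎ (1 ℕ.≤ y × y ℕ.≤ x × v ∈ tails 0 y r)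
∈-runs⁻ x {r} p with ∈-++⁻ (map (suc x ∷_) (runs (suc x) r)) p
... | inj₁ q = inj₁ (∈-map∷⁻ q)
... | inj₂ q = inj₂ (∈-firsts⁻ x q)

unique-∷++ : ∀ {r} x {vs : List (Vec ℕ r)} {ws} → Unique vs → Unique ws →
             (∀ {y v} → y ∷ v ∈ ws → y ≢ x) → Unique (map (x ∷_) vs ++ ws)
unique-∷++ x u v y≢x = Unique.++⁺ (Unique.map⁺ Vec.∷-injectiveʳ u) v
  λ { {y ∷ _} (p , q) → y≢x q (proj₁ (∈-map∷⁻ p)) }

unique-tails : ∀ s g r → Unique (tails s g r)
unique-drops : ∀ s g r → Unique (drops s g r)
unique-tails s g zero    = All.[] ∷ []
unique-tails s g (suc r) = unique-drops (suc s) (suc g) r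
unique-drops s zero    r = []
unique-drops s (suc g) r = unique-∷++ (s ℕ.+ g) (unique-tails s g r) (unique-drops s g r)
  λ q e → let g′ , g′<g , e′ , _ = ∈-drops⁻ s g q
          in ℕ.<-irrefl (ℕ.+-cancelˡ-≡ s _ _ (trans (sym e′) e)) g′<g

unique-firsts : ∀ x r → Unique (firsts x r)
unique-firsts zero    r = []
unique-firsts (suc x) r = unique-∷++ (suc x) (unique-tails 0 (suc x) r) (unique-firsts x r)
  λ q e → ℕ.<-irrefl e (ℕ.s≤s (proj₁ (proj₂ (∈-firsts⁻ x q))))

unique-runs : ∀ x r → Unique (runs x r)
unique-runs x zero    = All.[] ∷ []
unique-runs x (suc r) = unique-∷++ (suc x) (unique-runs (suc x) r) (unique-firsts x r)
  λ q e → ℕ.<-irrefl e (ℕ.s≤s (proj₁ (proj₂ (∈-firsts⁻ x q))))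

-- The area condition joined with connectedness: an entry is at least 1 exactly when its vertex is
-- adjacent to the preceding one.
Steps : ∀ {r} → ℕ → Vec ℕ r → Set
Steps x []      = ⊤
Steps x (y ∷ v) = 1 ℕ.≤ y × y ℕ.≤ suc x × Steps y v

final : ∀ {r} → ℕ → Vec ℕ r → ℕ
final x []      = x
final x (y ∷ v) = final y v

final-≤ : ∀ {r} x (v : Vec ℕ r) → Steps x v → final x v ℕ.≤ x ℕ.+ r
final-≤ x []      _            = ℕ.m≤m+n x 0
final-≤ {suc r} x (y ∷ v) (_ , y≤ , st) = begin
  final y v      ≤⟨ final-≤ y v st ⟩
  y ℕ.+ r        ≤⟨ ℕ.+-monoˡ-≤ r y≤ ⟩
  suc x ℕ.+ r    ≡⟨ ℕ.+-suc x r ⟨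
  x ℕ.+ suc r    ∎
  where open ℕ.≤-Reasoning

tails-sound : ∀ s g {r} (v : Vec ℕ r) → v ∈ tails s g r →
              Steps (s ℕ.+ g) v × s ℕ.+ r ℕ.≤ final (s ℕ.+ g) v
tails-sound s g []      _ = tt , ℕ.+-monoʳ-≤ s ℕ.z≤n
tails-sound s g {suc r} (y ∷ v) p with ∈-drops⁻ (suc s) (suc g) p
... | g′ , ℕ.s≤s g′≤g , refl , t =
  let st , fin = tails-sound (suc s) g′ v t
  in (ℕ.s≤s ℕ.z≤n , ℕ.s≤s (ℕ.+-monoʳ-≤ s g′≤g) , st)
   , ℕ.≤-trans (ℕ.≤-reflexive (ℕ.+-suc s r)) fin

-- A lower bound on the last entry controls all the others: entries rise by at most 1, so by
-- `final-≤` the next one is at least `suc s`, and its excess over `suc s` is the next `g`.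
tails-complete : ∀ s g {r} (v : Vec ℕ r) → Steps (s ℕ.+ g) v → s ℕ.+ r ℕ.≤ final (s ℕ.+ g) v →
                 v ∈ tails s g r
tails-complete s g []      _ _ = here refl
tails-complete s g {suc r} (y ∷ v) (1≤y , y≤ , st) fin =
  subst (λ z → z ∷ v ∈ drops (suc s) (suc g) r) y≡
    (∈-drops⁺ (suc s) (suc g) (y ℕ.∸ suc s) (ℕ.s≤s (ℕ.m≤n+o⇒m∸n≤o y (suc s) y≤))
      (tails-complete (suc s) (y ℕ.∸ suc s) v (subst (λ z → Steps z v) (sym y≡) st)
        (subst (λ z → suc s ℕ.+ r ℕ.≤ final z v) (sym y≡) s+r≤)))
  where
  s+r≤ : suc s ℕ.+ r ℕ.≤ final y v
  s+r≤ = ℕ.≤-trans (ℕ.≤-reflexive (sym (ℕ.+-suc s r))) fin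
  y≡ : suc s ℕ.+ (y ℕ.∸ suc s) ≡ y
  y≡ = ℕ.m+[n∸m]≡n (ℕ.+-cancelʳ-≤ r (suc s) y (ℕ.≤-trans s+r≤ (final-≤ y v st)))

-- Every entry of v, sitting at position suc (p + i) of a sequence with last
-- position m and last entry f, is adjacent to the first or the last vertex.
Reaches : ∀ {r} → ℕ → ℕ → ℕ → Vec ℕ r → Set
Reaches m f p v = ∀ i → suc (p ℕ.+ toℕ i) ℕ.< m →
  suc (p ℕ.+ toℕ i) ℕ.≤ lookup v i ⊎ m ℕ.≤ f ℕ.+ suc (p ℕ.+ toℕ i)

runs-sound : ∀ x {r} (v : Vec ℕ r) → v ∈ runs x r → Steps x v × Reaches (x ℕ.+ r) (final x v) x v
runs-sound x [] _ = tt , λ ()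
runs-sound x {suc r} (y ∷ v) p with ∈-runs⁻ x p
... | inj₁ (refl , t) =
  let st , re = runs-sound (suc x) v t
  in (ℕ.s≤s ℕ.z≤n , ℕ.≤-refl , st) , λ where
    Fin.zero    _ → inj₁ (ℕ.s≤s (ℕ.≤-reflexive (ℕ.+-identityʳ x)))
    (Fin.suc i)   → subst₂ (λ q m → suc q ℕ.< m → suc q ℕ.≤ lookup v i ⊎ m ℕ.≤ final (suc x) v ℕ.+ suc q)
                      (sym (ℕ.+-suc x (toℕ i))) (sym (ℕ.+-suc x r)) (re i)
... | inj₂ (1≤y , y≤x , t) =
  let st , fin = tails-sound 0 y v t
  in (1≤y , ℕ.m≤n⇒m≤1+n y≤x , st) , λ i _ → inj₂ (begin
    x ℕ.+ suc r                           ≡⟨ ℕ.+-suc x r ⟩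
    suc (x ℕ.+ r)                         ≤⟨ ℕ.s≤s (ℕ.+-mono-≤ (ℕ.m≤m+n x (toℕ i)) fin) ⟩
    suc (x ℕ.+ toℕ i) ℕ.+ final y v       ≡⟨ ℕ.+-comm (suc (x ℕ.+ toℕ i)) (final y v) ⟩
    final y v ℕ.+ suc (x ℕ.+ toℕ i)       ∎)
  where open ℕ.≤-Reasoning

runs-complete : ∀ x {r} (v : Vec ℕ r) → Steps x v → Reaches (x ℕ.+ r) (final x v) x v → v ∈ runs x r
runs-complete x [] _ _ = here refl
runs-complete x {suc r} (y ∷ v) (1≤y , y≤ , st) re with ℕ.m≤n⇒m<n∨m≡n y≤
... | inj₂ refl = ∈-++⁺ˡ (∈-map⁺ (y ∷_) (runs-complete (suc x) v st λ i →
  subst₂ (λ q m → suc q ℕ.< m → suc q ℕ.≤ lookup v i ⊎ m ℕ.≤ final (suc x) v ℕ.+ suc q)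
    (ℕ.+-suc x (toℕ i)) (ℕ.+-suc x r) (re (Fin.suc i))))
... | inj₁ (ℕ.s≤s y≤x) = ∈-++⁺ʳ (map (suc x ∷_) (runs (suc x) r))
  (∈-firsts⁺ x y 1≤y y≤x (tails-complete 0 y v st (fin r re)))
  where
  -- As `y ≤ x`, this vertex is not adjacent to the first and must be adjacent to the last, which
  -- bounds the last entry from below. For `r = 0` it is the last vertex itself and there is nothing
  -- to ask.
  fin : ∀ r → (Reaches (x ℕ.+ suc r) (final y v) x (y ∷ v)) → r ℕ.≤ final y v
  fin zero    _  = ℕ.z≤n
  fin (suc r) re with re Fin.zero (ℕ.≤-trans (ℕ.≤-reflexive (cong (2 ℕ.+_) (ℕ.+-identityʳ x)))
                       (ℕ.≤-trans (ℕ.m≤m+n (2 ℕ.+ x) r) (ℕ.≤-reflexive (sym (trans (ℕ.+-suc x (suc r)) (cong suc (ℕ.+-suc x r)))))))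
  ... | inj₁ q = contradiction (ℕ.≤-trans q y≤x) (ℕ.<-irrefl (ℕ.+-identityʳ x))
  ... | inj₂ q = ℕ.+-cancelˡ-≤ (suc x) (suc r) (final y v) (begin
    suc x ℕ.+ suc r                  ≡⟨ ℕ.+-suc x (suc r) ⟨
    x ℕ.+ suc (suc r)                ≤⟨ q ⟩
    final y v ℕ.+ suc (x ℕ.+ 0)      ≡⟨ cong (λ z → final y v ℕ.+ suc z) (ℕ.+-identityʳ x) ⟩
    final y v ℕ.+ suc x              ≡⟨ ℕ.+-comm (final y v) (suc x) ⟩
    suc x ℕ.+ final y v              ∎)
    where open ℕ.≤-Reasoning

-- From the graph conditions to the enumeration and back

steps : ∀ {r} x (v : Vec ℕ r) →
        (∀ i j → toℕ j ≡ suc (toℕ i) → lookup (x ∷ v) j ℕ.≤ suc (lookup (x ∷ v) i)) →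
        (∀ j → 1 ℕ.≤ lookup v j) → Steps x v
steps x []      up pos = tt
steps x (y ∷ v) up pos = pos Fin.zero , up Fin.zero (Fin.suc Fin.zero) refl
  , steps y v (λ i j e → up (Fin.suc i) (Fin.suc j) (cong suc e)) (λ j → pos (Fin.suc j))

steps-pos : ∀ {r} x (v : Vec ℕ r) → Steps x v → ∀ j → 1 ℕ.≤ lookup v j
steps-pos x (y ∷ v) (1≤y , _ , st) Fin.zero    = 1≤y
steps-pos x (y ∷ v) (_ , _ , st)   (Fin.suc j) = steps-pos y v st j

steps-up : ∀ {r} x (v : Vec ℕ r) → Steps x v → ∀ i j → toℕ j ≡ suc (toℕ i) →
           lookup (x ∷ v) j ℕ.≤ suc (lookup (x ∷ v) i)
steps-up x (y ∷ v) (_ , y≤ , st) Fin.zero (Fin.suc Fin.zero) refl = y≤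
steps-up x (y ∷ v) (_ , _ , st) (Fin.suc i) (Fin.suc j) e = steps-up y v st i j (ℕ.suc-injective e)

steps-≤ : ∀ {r} x (v : Vec ℕ r) → Steps x v → ∀ i → lookup (x ∷ v) i ℕ.≤ x ℕ.+ toℕ i
steps-≤ x v       st           Fin.zero    = ℕ.m≤m+n x 0
steps-≤ x (y ∷ v) (_ , y≤ , st) (Fin.suc i) = ℕ.≤-trans (steps-≤ y v st i)
  (ℕ.≤-trans (ℕ.+-monoˡ-≤ (toℕ i) y≤) (ℕ.≤-reflexive (sym (ℕ.+-suc x (toℕ i)))))

lookup-final : ∀ {r} x (v : Vec ℕ r) → lookup (x ∷ v) (fromℕ r) ≡ final x v
lookup-final x []      = refl
lookup-final x (y ∷ v) = lookup-final y v

m∸n≤o⇒m≤n+o : ∀ m n {o} → m ℕ.∸ n ℕ.≤ o → m ℕ.≤ n ℕ.+ o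
m∸n≤o⇒m≤n+o m n p = ℕ.≤-trans (ℕ.m≤n+m∸n m n) (ℕ.+-monoʳ-≤ n p)

connAbelian⇒runs : ∀ {m} (a : Vec ℕ (suc m)) → ConnAbelianArea a →
                   Σ (Vec ℕ m) λ v → a ≡ 0 ∷ v × v ∈ runs 0 m
connAbelian⇒runs {m} (x ∷ v) (area@(below , up) , ab , conn) with below Fin.zero
... | ℕ.s≤s ℕ.z≤n = v , refl , runs-complete 0 v (steps 0 v up pos) reaches
  where
  pos : ∀ j → 1 ℕ.≤ lookup v j
  pos j with connected⇒consecutive (0 ∷ v) area conn (inject₁ j) (Fin.suc j) (cong suc (sym (Fin.toℕ-inject₁ j)))
  ... | inj₁ (_ , q) = ℕ.+-cancelʳ-≤ (toℕ j) 1 (lookup v j)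
        (m∸n≤o⇒m≤n+o (suc (toℕ j)) (lookup v j) (ℕ.≤-trans q (ℕ.≤-reflexive (Fin.toℕ-inject₁ j))))
  ... | inj₂ (q , _) = contradiction q (ℕ.<-asym (ℕ.≤-reflexive (cong suc (Fin.toℕ-inject₁ j))))
  reaches : Reaches m (final 0 v) 0 v
  reaches i i<m with ab (Fin.suc i) (λ ()) (λ e → ℕ.<-irrefl (trans (cong toℕ e) (Fin.toℕ-fromℕ m)) i<m)
  ... | inj₁ (inj₂ (_ , q)) = inj₁ (ℕ.≤-trans (m∸n≤o⇒m≤n+o (suc (toℕ i)) (lookup v i) q) (ℕ.≤-reflexive (ℕ.+-identityʳ (lookup v i))))
  ... | inj₂ (inj₁ (_ , q)) = inj₂ (m∸n≤o⇒m≤n+o m (final 0 v)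
        (subst₂ (λ b c → b ℕ.∸ c ℕ.≤ suc (toℕ i)) (Fin.toℕ-fromℕ m) (lookup-final 0 v) q))
  ... | inj₂ (inj₂ (q , _)) = contradiction (subst (ℕ._< suc (toℕ i)) (Fin.toℕ-fromℕ m) q) (ℕ.<-asym i<m)

runs⇒connAbelian : ∀ {m} (v : Vec ℕ m) → v ∈ runs 0 m → ConnAbelianArea (0 ∷ v)
runs⇒connAbelian {m} v p = ((λ i → ℕ.s≤s (steps-≤ 0 v st i)) , steps-up 0 v st) , abelian
  , consecutive⇒connected (0 ∷ v) consecutive
  where
  st = proj₁ (runs-sound 0 v p)
  reaches = proj₂ (runs-sound 0 v p)
  consecutive : Consecutive (0 ∷ v)
  consecutive i (Fin.suc j) e = inj₁ (ℕ.≤-reflexive (sym e) , ℕ.≤-trans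
    (ℕ.m≤n+o⇒m∸n≤o (suc (toℕ j)) (lookup v j) (ℕ.+-monoˡ-≤ (toℕ j) (steps-pos 0 v st j)))
    (ℕ.≤-reflexive (ℕ.suc-injective e)))
  abelian : Abelian (0 ∷ v)
  abelian Fin.zero    i≢0 _ = contradiction refl i≢0
  abelian (Fin.suc i) _ i≢m with reaches i i<m
    where
    i<m : suc (toℕ i) ℕ.< m
    i<m = ℕ.≤∧≢⇒< (Fin.toℕ<n i) λ e → i≢m (Fin.toℕ-injective (trans e (sym (Fin.toℕ-fromℕ m))))
  ... | inj₁ q = inj₁ (inj₂ (ℕ.s≤s ℕ.z≤n , ℕ.≤-reflexive (ℕ.m≤n⇒m∸n≡0 q)))
  ... | inj₂ q = inj₂ (inj₁
    ( subst (suc (toℕ i) ℕ.<_) (sym (Fin.toℕ-fromℕ m)) (ℕ.≤∧≢⇒< (Fin.toℕ<n i) λ e → i≢m (Fin.toℕ-injective (trans e (sym (Fin.toℕ-fromℕ m)))))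
    , subst₂ (λ b c → b ℕ.∸ c ℕ.≤ suc (toℕ i)) (sym (Fin.toℕ-fromℕ m)) (sym (lookup-final 0 v)) (ℕ.m≤n+o⇒m∸n≤o m (final 0 v) q)))

abelianSeqs-↭ : ∀ m → abelianSeqs m ↭ map (0 ∷_) (runs 0 m)
abelianSeqs-↭ m = unique-↭ (abelianSeqs-unique m) (Unique.map⁺ Vec.∷-injectiveʳ (unique-runs 0 m))
  (λ {a} p → let v , e , q = connAbelian⇒runs a (abelianSeqs-sound p)
             in subst (_∈ map (0 ∷_) (runs 0 m)) (sym e) (∈-map⁺ (0 ∷_) q))
  (λ {a} p → let v , q , e = ∈-map⁻ (0 ∷_) p
             in subst (_∈ abelianSeqs m) (sym e) (∈-abelianSeqs (0 ∷ v) (runs⇒connAbelian v q)))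

-- Peaks

-- The last entry always counts, since no ascent can follow it.
nonascents : ∀ {r} → ℕ → Vec ℕ r → ℕ
nonascents x []      = 1
nonascents x (y ∷ v) with y ℕ.≟ suc x
... | yes _ = nonascents y v
... | no  _ = suc (nonascents y v)

NonAscent : ∀ {n} → Vec ℕ n → Fin n → Set
NonAscent a j = 1 ℕ.≤ lookup a j × (∀ j′ → toℕ j′ ≡ suc (toℕ j) → lookup a j′ ℕ.≤ lookup a j)

nonAscent? : ∀ {n} (a : Vec ℕ n) → Decidable (NonAscent a)
nonAscent? a j = (1 ℕ.≤? lookup a j) ×-dec
  Fin.all? (λ j′ → (toℕ j′ ℕ.≟ suc (toℕ j)) →-dec (lookup a j′ ℕ.≤? lookup a j))

filter-map : ∀ {A B : Set} {P : B → Set} {Q : A → Set} (P? : Decidable P) (Q? : Decidable Q) (f : A → B) →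
             (∀ {x} → P (f x) → Q x) → (∀ {x} → Q x → P (f x)) →
             ∀ xs → length (filter P? (map f xs)) ≡ length (filter Q? xs)
filter-map P? Q? f pq qp [] = refl
filter-map P? Q? f pq qp (x ∷ xs) with Q? x
... | yes q = trans (cong length (List.filter-accept P? (qp q))) (cong suc (filter-map P? Q? f pq qp xs))
... | no ¬q = trans (cong length (List.filter-reject P? (¬q ∘ pq))) (filter-map P? Q? f pq qp xs)

count-nonAscents : ∀ {n} → Vec ℕ n → ℕ
count-nonAscents {n} a = length (filter (nonAscent? a) (allFin n))

count-suc : ∀ {r} x (v : Vec ℕ r) →
            length (filter (nonAscent? (x ∷ v)) (List.tabulate Fin.suc)) ≡ count-nonAscents v
count-suc {r} x v = trans
  (cong (length ∘ filter (nonAscent? (x ∷ v))) (sym (List.map-tabulate (λ i → i) Fin.suc)))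
  (filter-map (nonAscent? (x ∷ v)) (nonAscent? v) Fin.suc
    (λ { (p , h) → p , λ j e → h (Fin.suc j) (cong suc e) })
    (λ { (p , h) → p , λ { (Fin.suc j) e → h j (ℕ.suc-injective e) } })
    (allFin r))

count-yes : ∀ {r} x (v : Vec ℕ r) → NonAscent (x ∷ v) Fin.zero →
            count-nonAscents (x ∷ v) ≡ suc (count-nonAscents v)
count-yes x v p = trans
  (cong length (List.filter-accept (nonAscent? (x ∷ v)) {x = Fin.zero} {xs = List.tabulate Fin.suc} p))
  (cong suc (count-suc x v))

count-no : ∀ {r} x (v : Vec ℕ r) → ¬ NonAscent (x ∷ v) Fin.zero →
           count-nonAscents (x ∷ v) ≡ count-nonAscents v
count-no x v ¬p = trans
  (cong length (List.filter-reject (nonAscent? (x ∷ v)) {x = Fin.zero} {xs = List.tabulate Fin.suc} ¬p))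
  (count-suc x v)

count≡nonascents : ∀ {r} x (v : Vec ℕ r) → 1 ℕ.≤ x → Steps x v → count-nonAscents (x ∷ v) ≡ nonascents x v
count≡nonascents x [] 1≤x _ = count-yes x [] (1≤x , λ { Fin.zero () })
count≡nonascents x (y ∷ v) 1≤x (1≤y , y≤ , st) with y ℕ.≟ suc x
... | yes refl = trans
  (count-no x (y ∷ v) λ { (_ , h) → ℕ.<-irrefl refl (h (Fin.suc Fin.zero) refl) })
  (count≡nonascents y v 1≤y st)
... | no y≢ = trans
  (count-yes x (y ∷ v) (1≤x , λ { (Fin.suc Fin.zero) refl → ℕ.s≤s⁻¹ (ℕ.≤∧≢⇒< y≤ y≢) }))
  (cong suc (count≡nonascents y v 1≤y st))

-- A peak-edge with larger end `j` must start at the lowest neighbour `low j`. That edge is a peak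
-- exactly when the next vertex does not reach down to `low j`, which means that the next entry is
-- not larger.
module Peaks {n} (a : Vec ℕ n) (below : ∀ i → lookup a i ℕ.≤ toℕ i) where

  low : Fin n → Fin n
  low j = fromℕ< (ℕ.≤-<-trans (ℕ.m∸n≤m (toℕ j) (lookup a j)) (Fin.toℕ<n j))

  toℕ-low : ∀ j → toℕ (low j) ≡ toℕ j ℕ.∸ lookup a j
  toℕ-low j = Fin.toℕ-fromℕ< _

  peakPair⇒low : ∀ {i j} → PeakPair a (i , j) → i ≡ low j × NonAscent a j
  peakPair⇒low {i} {j} ((i<j , le) , noRight , noLeft) = Fin.toℕ-injective (trans i≡ (sym (toℕ-low j))) , 1≤ , nonasc
    where
    1≤ : 1 ℕ.≤ lookup a j
    1≤ = ℕ.n≢0⇒n>0 λ e → ℕ.<⇒≱ i<j (subst (λ z → toℕ j ℕ.∸ z ℕ.≤ toℕ i) e le)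
    i≡ : toℕ i ≡ toℕ j ℕ.∸ lookup a j
    i≡ with ℕ.m≤n⇒m<n∨m≡n le
    ... | inj₂ e = sym e
    ... | inj₁ l = contradiction (inj₁ (edge i refl l)) (noLeft (pred i l) (pred-eq i l))
      where
      pred : ∀ i → toℕ j ℕ.∸ lookup a j ℕ.< toℕ i → Fin n
      pred (Fin.suc i) _ = inject₁ i
      pred-eq : ∀ i l → suc (toℕ (pred i l)) ≡ toℕ i
      pred-eq (Fin.suc i) _ = cong suc (Fin.toℕ-inject₁ i)
      edge : ∀ k → k ≡ i → (l : toℕ j ℕ.∸ lookup a j ℕ.< toℕ k) → Edge a (pred k l) j
      edge k refl l = ℕ.<-trans (ℕ.≤-reflexive (pred-eq k l)) i<j
                    , ℕ.s≤s⁻¹ (ℕ.≤-trans l (ℕ.≤-reflexive (sym (pred-eq k l))))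
    nonasc : ∀ j′ → toℕ j′ ≡ suc (toℕ j) → lookup a j′ ℕ.≤ lookup a j
    nonasc j′ e = ℕ.≮⇒≥ λ l → noRight j′ e (inj₁
      ( ℕ.<-trans i<j (ℕ.≤-reflexive (sym e))
      , ℕ.≤-trans (ℕ.∸-monoʳ-≤ (toℕ j′) l) (ℕ.≤-trans (ℕ.≤-reflexive (cong (ℕ._∸ suc (lookup a j)) e)) le)))

  low⇒peakPair : ∀ j → NonAscent a j → PeakPair a (low j , j)
  low⇒peakPair j (1≤ , h) = (i<j , ℕ.≤-reflexive (sym (toℕ-low j))) , noRight , noLeft
    where
    i<j : toℕ (low j) ℕ.< toℕ j
    i<j = subst (ℕ._< toℕ j) (sym (toℕ-low j))
      (ℕ.∸-monoʳ-< {toℕ j} {lookup a j} {0} 1≤ (below j))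
    noRight : ∀ j′ → toℕ j′ ≡ suc (toℕ j) → ¬ Adj a (low j) j′
    noRight j′ e (inj₁ (_ , le)) = ℕ.<-irrefl refl (begin-strict
      toℕ (low j)                       ≡⟨ toℕ-low j ⟩
      toℕ j ℕ.∸ lookup a j              <⟨ ℕ.≤-reflexive (sym (ℕ.+-∸-assoc 1 (below j))) ⟩
      suc (toℕ j) ℕ.∸ lookup a j        ≤⟨ ℕ.∸-monoʳ-≤ (suc (toℕ j)) (h j′ e) ⟩
      suc (toℕ j) ℕ.∸ lookup a j′       ≡⟨ cong (ℕ._∸ lookup a j′) e ⟨
      toℕ j′ ℕ.∸ lookup a j′            ≤⟨ le ⟩
      toℕ (low j)                       ∎)
      where open ℕ.≤-Reasoning
    noRight j′ e (inj₂ (l , _)) = ℕ.<-asym (ℕ.<-trans i<j (ℕ.≤-reflexive (sym e))) l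
    noLeft : ∀ i′ → suc (toℕ i′) ≡ toℕ (low j) → ¬ Adj a i′ j
    noLeft i′ e (inj₁ (_ , le)) = ℕ.<-irrefl refl
      (ℕ.≤-trans (ℕ.≤-reflexive e) (ℕ.≤-trans (ℕ.≤-reflexive (toℕ-low j)) le))
    noLeft i′ e (inj₂ (l , _)) = ℕ.<-asym l (ℕ.<-trans (ℕ.≤-reflexive e) i<j)

  count-peakPairs : length (filter (peakPair? a) (cartesianProduct (allFin n) (allFin n))) ≡ count-nonAscents a
  count-peakPairs = trans (↭-length (unique-↭
      (Unique.filter⁺ (peakPair? a) (Unique.cartesianProduct⁺ (Unique.allFin⁺ n) (Unique.allFin⁺ n)))
      (Unique.map⁺ (cong proj₂) (Unique.filter⁺ (nonAscent? a) (Unique.allFin⁺ n))) to from))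
    (List.length-map (λ j → low j , j) (filter (nonAscent? a) (allFin n)))
    where
    pairs = filter (peakPair? a) (cartesianProduct (allFin n) (allFin n))
    lows = map (λ j → low j , j) (filter (nonAscent? a) (allFin n))
    to : ∀ {x} → x ∈ pairs → x ∈ lows
    to {i , j} p =
      let e , na = peakPair⇒low (proj₂ (∈-filter⁻ (peakPair? a) {xs = cartesianProduct (allFin n) (allFin n)} p))
      in subst (λ k → (k , j) ∈ lows) (sym e) (∈-map⁺ (λ j → low j , j) (∈-filter⁺ (nonAscent? a) (∈-allFin j) na))
    from : ∀ {x} → x ∈ lows → x ∈ pairs
    from p with ∈-map⁻ (λ j → low j , j) p
    ... | j , q , refl = ∈-filter⁺ (peakPair? a) (∈-cartesianProduct⁺ (∈-allFin (low j)) (∈-allFin j))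
      (low⇒peakPair j (proj₂ (∈-filter⁻ (nonAscent? a) {xs = allFin n} q)))

no-isolated : ∀ {r} (a : Vec ℕ (suc (suc r))) → Consecutive a → filter (isolated? a) (allFin (suc (suc r))) ≡ []
no-isolated {r} a cons = List.filter-none (isolated? a) (All.universal neighbour (allFin (suc (suc r))))
  where
  neighbour : ∀ i → ¬ Isolated a i
  neighbour Fin.zero    iso = iso (Fin.suc Fin.zero) (cons Fin.zero (Fin.suc Fin.zero) refl)
  neighbour (Fin.suc i) iso = iso (inject₁ i)
    (adj-sym a {inject₁ i} {Fin.suc i} (cons (inject₁ i) (Fin.suc i) (cong suc (sym (Fin.toℕ-inject₁ i)))))

peak≡nonascents : ∀ {m} (v : Vec ℕ m) → v ∈ runs 0 m → peak (0 ∷ v) ≡ nonascents 0 v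
-- The single vertex is isolated and counts as one peak-edge, in agreement with the count 1 for the
-- last entry.
peak≡nonascents []              _ = refl
peak≡nonascents (y ∷ v) p with runs⇒connAbelian (y ∷ v) p | proj₁ (runs-sound 0 (y ∷ v) p)
... | area , _ , conn | 1≤y , y≤1 , st with ℕ.≤-antisym y≤1 1≤y
...   | refl = trans (cong₂ ℕ._+_
    (cong length (no-isolated (0 ∷ 1 ∷ v) (connected⇒consecutive (0 ∷ 1 ∷ v) area conn)))
    (Peaks.count-peakPairs (0 ∷ 1 ∷ v) (λ i → ℕ.s≤s⁻¹ (proj₁ area i))))
  (trans (count-no 0 (1 ∷ v) λ { (() , _) }) (count≡nonascents 1 v 1≤y st))

-- Evaluation of the generating polynomial

module Sums (w : ℚ[i]) where

  total : ∀ {A : Set} → (A → ℕ) → List A → ℚ[i]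
  total f []       = 0𝕚
  total f (x ∷ xs) = w ^𝕚 f x ⊕ total f xs

  total-cong : ∀ {A : Set} {f g : A → ℕ} xs → (∀ {x} → x ∈ xs → f x ≡ g x) → total f xs ≡ total g xs
  total-cong []       h = refl
  total-cong (x ∷ xs) h = cong₂ (λ k s → w ^𝕚 k ⊕ s) (h (here refl)) (total-cong xs (h ∘ there))

  total-suc : ∀ {A : Set} {f g : A → ℕ} xs → (∀ {x} → x ∈ xs → f x ≡ suc (g x)) → total f xs ≡ w ⊗ total g xs
  total-suc []       h = sym (zeroʳ w)
    where
    zeroʳ : ∀ w → w ⊗ 0𝕚 ≡ 0𝕚
    zeroʳ = solve-∀ ring𝕚
  total-suc {g = g} (x ∷ xs) h = trans
    (cong₂ (λ k s → w ^𝕚 k ⊕ s) (h (here refl)) (total-suc xs (h ∘ there)))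
    (factor-out w (w ^𝕚 g x) (total g xs))
    where
    factor-out : ∀ w p s → w ⊗ p ⊕ w ⊗ s ≡ w ⊗ (p ⊕ s)
    factor-out = solve-∀ ring𝕚

  total-map : ∀ {A B : Set} (f : B → ℕ) (h : A → B) xs → total f (map h xs) ≡ total (f ∘ h) xs
  total-map f h []       = refl
  total-map f h (x ∷ xs) = cong (w ^𝕚 f (h x) ⊕_) (total-map f h xs)

  total-++ : ∀ {A : Set} (f : A → ℕ) xs ys → total f (xs ++ ys) ≡ total f xs ⊕ total f ys
  total-++ f []       ys = sym (zeroˡ (total f ys))
    where
    zeroˡ : ∀ a → 0𝕚 ⊕ a ≡ a
    zeroˡ = solve-∀ ring𝕚
  total-++ f (x ∷ xs) ys = trans (cong (w ^𝕚 f x ⊕_) (total-++ f xs ys)) (assoc (w ^𝕚 f x) (total f xs) (total f ys))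
    where
    assoc : ∀ a b c → a ⊕ (b ⊕ c) ≡ a ⊕ b ⊕ c
    assoc = solve-∀ ring𝕚

  total-↭ : ∀ {A : Set} (f : A → ℕ) {xs ys} → xs ↭ ys → total f xs ≡ total f ys
  total-↭ f _↭_.refl            = refl
  total-↭ f (_↭_.prep x p)          = cong (w ^𝕚 f x ⊕_) (total-↭ f p)
  total-↭ f (_↭_.trans p q)     = trans (total-↭ f p) (total-↭ f q)
  total-↭ f {ys = _ ∷ _ ∷ ys} (_↭_.swap x y p) = trans
    (cong (λ s → w ^𝕚 f x ⊕ (w ^𝕚 f y ⊕ s)) (total-↭ f p)) (exchange (w ^𝕚 f x) (w ^𝕚 f y) (total f ys))
    where
    exchange : ∀ a b c → a ⊕ (b ⊕ c) ≡ b ⊕ (a ⊕ c)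
    exchange = solve-∀ ring𝕚

  -- `F g r` enumerates the sequences `g ≥ g₁ ≥ … ≥ gᵣ ≥ 0` by strict drops; its closed form is
  -- `Σⱼ C(g, j) C(r, j) wʲ`. `G g` sums `F` over all `g′ < g`.
  F G : ℕ → ℕ → ℚ[i]
  F g zero    = 1𝕚
  F g (suc r) = F g r ⊕ w ⊗ G g r
  G zero    r = 0𝕚
  G (suc g) r = F g r ⊕ G g r

  F-zero : ∀ r → F 0 r ≡ 1𝕚
  F-zero zero    = refl
  F-zero (suc r) = trans (cong (_⊕ w ⊗ 0𝕚) (F-zero r)) (absorb w)
    where
    absorb : ∀ w → 1𝕚 ⊕ w ⊗ 0𝕚 ≡ 1𝕚
    absorb = solve-∀ ring𝕚

  nonascents-≡ : ∀ {r} x (v : Vec ℕ r) → nonascents x (suc x ∷ v) ≡ nonascents (suc x) v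
  nonascents-≡ x v with suc x ℕ.≟ suc x
  ... | yes _ = refl
  ... | no ¬p = contradiction refl ¬p

  nonascents-≤ : ∀ {r} {x y} (v : Vec ℕ r) → y ℕ.≤ x → nonascents x (y ∷ v) ≡ suc (nonascents y v)
  nonascents-≤ {x = x} {y} v y≤x with y ℕ.≟ suc x
  ... | yes refl = contradiction y≤x ℕ.1+n≰n
  ... | no _     = refl

  total-≤ : ∀ {r x y} (vs : List (Vec ℕ r)) → y ℕ.≤ x →
            total (nonascents x) (map (y ∷_) vs) ≡ w ⊗ total (nonascents y) vs
  total-≤ {x = x} {y} vs y≤x = trans (total-map (nonascents x) (y ∷_) vs) (total-suc vs λ {v} _ → nonascents-≤ v y≤x)

  total-≡ : ∀ {r} x (vs : List (Vec ℕ r)) →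
            total (nonascents x) (map (suc x ∷_) vs) ≡ total (nonascents (suc x)) vs
  total-≡ x vs = trans (total-map (nonascents x) (suc x ∷_) vs) (total-cong vs λ {v} _ → nonascents-≡ x v)

  -- A step is an ascent exactly when `g` is kept, so each strict drop costs a factor `w`. The
  -- leading `w` belongs to the last entry.
  total-tails : ∀ s g r → total (nonascents (s ℕ.+ g)) (tails s g r) ≡ w ⊗ F g r
  total-drops : ∀ s g r x → s ℕ.+ g ℕ.≤ suc x → total (nonascents x) (drops s g r) ≡ w ⊗ (w ⊗ G g r)
  total-tails s g zero    = unit w
    where
    unit : ∀ w → w ⊗ 1𝕚 ⊕ 0𝕚 ≡ w ⊗ 1𝕚
    unit = solve-∀ ring𝕚
  total-tails s g (suc r) = begin
    total (nonascents x) (map (suc x ∷_) (tails (suc s) g r) ++ drops (suc s) g r)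
      ≡⟨ total-++ (nonascents x) (map (suc x ∷_) (tails (suc s) g r)) (drops (suc s) g r) ⟩
    total (nonascents x) (map (suc x ∷_) (tails (suc s) g r)) ⊕ total (nonascents x) (drops (suc s) g r)
      ≡⟨ cong₂ _⊕_ (trans (total-≡ x (tails (suc s) g r)) (total-tails (suc s) g r))
                   (total-drops (suc s) g r x ℕ.≤-refl) ⟩
    w ⊗ F g r ⊕ w ⊗ (w ⊗ G g r)
      ≡⟨ factor-out w (F g r) (G g r) ⟩
    w ⊗ F g (suc r) ∎
    where
    open ≡-Reasoning
    x = s ℕ.+ g
    factor-out : ∀ w a b → w ⊗ a ⊕ w ⊗ (w ⊗ b) ≡ w ⊗ (a ⊕ w ⊗ b)
    factor-out = solve-∀ ring𝕚
  total-drops s zero    r x _ = sym (zeroes w)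
    where
    zeroes : ∀ w → w ⊗ (w ⊗ 0𝕚) ≡ 0𝕚
    zeroes = solve-∀ ring𝕚
  total-drops s (suc g) r x le = begin
    total (nonascents x) (map (s ℕ.+ g ∷_) (tails s g r) ++ drops s g r)
      ≡⟨ total-++ (nonascents x) (map (s ℕ.+ g ∷_) (tails s g r)) (drops s g r) ⟩
    total (nonascents x) (map (s ℕ.+ g ∷_) (tails s g r)) ⊕ total (nonascents x) (drops s g r)
      ≡⟨ cong₂ _⊕_ (trans (total-≤ (tails s g r) s+g≤x) (cong (w ⊗_) (total-tails s g r)))
                   (total-drops s g r x (ℕ.m≤n⇒m≤1+n s+g≤x)) ⟩
    w ⊗ (w ⊗ F g r) ⊕ w ⊗ (w ⊗ G g r)
      ≡⟨ factor-out w (F g r) (G g r) ⟩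
    w ⊗ (w ⊗ G (suc g) r) ∎
    where
    open ≡-Reasoning
    s+g≤x : s ℕ.+ g ℕ.≤ x
    s+g≤x = ℕ.s≤s⁻¹ (ℕ.≤-trans (ℕ.≤-reflexive (sym (ℕ.+-suc s g))) le)
    factor-out : ∀ w a b → w ⊗ (w ⊗ a) ⊕ w ⊗ (w ⊗ b) ≡ w ⊗ (w ⊗ (a ⊕ b))
    factor-out = solve-∀ ring𝕚

  -- `G (suc y) r` includes the term `F 0 r = 1` of a first entry 0, which would disconnect the
  -- graph; hence `- 1`. One factor `w` is for the break of the run, the other for the last entry.
  total-firsts : ∀ y r x → y ℕ.≤ x → total (nonascents x) (firsts y r) ≡ w ⊗ (w ⊗ (G (suc y) r ⊕ ⊝ 1𝕚))
  total-firsts zero    r x _  = sym (trans (cong (λ a → w ⊗ (w ⊗ (a ⊕ 0𝕚 ⊕ ⊝ 1𝕚))) (F-zero r)) (zeroes w))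
    where
    zeroes : ∀ w → w ⊗ (w ⊗ (1𝕚 ⊕ 0𝕚 ⊕ ⊝ 1𝕚)) ≡ 0𝕚
    zeroes = solve-∀ ring𝕚
  total-firsts (suc y) r x le = begin
    total (nonascents x) (map (suc y ∷_) (tails 0 (suc y) r) ++ firsts y r)
      ≡⟨ total-++ (nonascents x) (map (suc y ∷_) (tails 0 (suc y) r)) (firsts y r) ⟩
    total (nonascents x) (map (suc y ∷_) (tails 0 (suc y) r)) ⊕ total (nonascents x) (firsts y r)
      ≡⟨ cong₂ _⊕_ (trans (total-≤ (tails 0 (suc y) r) le) (cong (w ⊗_) (total-tails 0 (suc y) r)))
                   (total-firsts y r x (ℕ.<⇒≤ le)) ⟩
    w ⊗ (w ⊗ F (suc y) r) ⊕ w ⊗ (w ⊗ (G (suc y) r ⊕ ⊝ 1𝕚))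
      ≡⟨ factor-out w (F (suc y) r) (G (suc y) r) ⟩
    w ⊗ (w ⊗ (G (suc (suc y)) r ⊕ ⊝ 1𝕚)) ∎
    where
    open ≡-Reasoning
    factor-out : ∀ w a b → w ⊗ (w ⊗ a) ⊕ w ⊗ (w ⊗ (b ⊕ ⊝ 1𝕚)) ≡ w ⊗ (w ⊗ (a ⊕ b ⊕ ⊝ 1𝕚))
    factor-out = solve-∀ ring𝕚

  -- Antidiagonal sums. From `x = 0` their coefficients are Vandermonde sums such as `Σᵢ C(i, j) C(N
  -- - i, j) = C(N + 1, 2j + 1)`; the two recursions below are those of `O` and `E` and replace the
  -- binomial identities.
  ΣF ΣG : ℕ → ℕ → ℚ[i]
  ΣF x zero    = F x 0
  ΣF x (suc r) = F x (suc r) ⊕ ΣF (suc x) r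
  ΣG x zero    = G x 0
  ΣG x (suc r) = G x (suc r) ⊕ ΣG (suc x) r

  ΣF-suc : ∀ x r → ΣF x (suc r) ≡ 1𝕚 ⊕ ΣF x r ⊕ w ⊗ ΣG x r
  ΣF-suc x zero    = rearrange (w ⊗ G x 0)
    where
    rearrange : ∀ a → 1𝕚 ⊕ a ⊕ 1𝕚 ≡ 1𝕚 ⊕ 1𝕚 ⊕ a
    rearrange = solve-∀ ring𝕚
  ΣF-suc x (suc r) = trans (cong (F x (suc (suc r)) ⊕_) (ΣF-suc (suc x) r))
    (rearrange w (F x (suc r)) (G x (suc r)) (ΣF (suc x) r) (ΣG (suc x) r))
    where
    rearrange : ∀ w a b c d → a ⊕ w ⊗ b ⊕ (1𝕚 ⊕ c ⊕ w ⊗ d) ≡ 1𝕚 ⊕ (a ⊕ c) ⊕ w ⊗ (b ⊕ d)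
    rearrange = solve-∀ ring𝕚

  ΣG-suc : ∀ x r → ΣG (suc x) r ≡ ΣF x r ⊕ ΣG x r
  ΣG-suc x zero    = refl
  ΣG-suc x (suc r) = trans (cong (G (suc x) (suc r) ⊕_) (ΣG-suc (suc x) r))
    (rearrange (F x (suc r)) (G x (suc r)) (ΣF (suc x) r) (ΣG (suc x) r))
    where
    rearrange : ∀ a b c d → a ⊕ b ⊕ (c ⊕ d) ≡ a ⊕ c ⊕ (b ⊕ d)
    rearrange = solve-∀ ring𝕚

  E≡ : ∀ N → E (suc N) w ≡ 1𝕚 ⊕ w ⊗ ΣG 0 N
  O≡ : ∀ N → O (suc N) w ≡ ΣF 0 N
  E≡ zero    = refl
  E≡ (suc N) = trans (cong₂ (λ a b → a ⊕ w ⊗ b) (E≡ N) (O≡ N))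
    (trans (rearrange w (ΣG 0 N) (ΣF 0 N)) (cong (λ a → 1𝕚 ⊕ w ⊗ (0𝕚 ⊕ a)) (sym (ΣG-suc 0 N))))
    where
    rearrange : ∀ w a b → 1𝕚 ⊕ w ⊗ a ⊕ w ⊗ b ≡ 1𝕚 ⊕ w ⊗ (0𝕚 ⊕ (b ⊕ a))
    rearrange = solve-∀ ring𝕚
  O≡ zero    = refl
  O≡ (suc N) = trans (cong₂ _⊕_ (E≡ N) (O≡ N)) (trans (rearrange (w ⊗ ΣG 0 N) (ΣF 0 N)) (sym (ΣF-suc 0 N)))
    where
    rearrange : ∀ a b → 1𝕚 ⊕ a ⊕ b ≡ 1𝕚 ⊕ b ⊕ a
    rearrange = solve-∀ ring𝕚

  -- The unbroken run gives `w`. Each of the `r` places for the first descent gives a term of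
  -- `ΣG x r` beyond its first, less 1; so `G x r` is removed and the ones add up to `ι r`.
  total-runs : ∀ x r → total (nonascents x) (runs x r) ≡
               w ⊕ w ⊗ (w ⊗ (ΣG x r ⊕ ⊝ (G x r ⊕ ofℚ (ι r))))
  total-runs x zero    = start w (G x 0)
    where
    start : ∀ w a → w ⊗ 1𝕚 ⊕ 0𝕚 ≡ w ⊕ w ⊗ (w ⊗ (a ⊕ ⊝ (a ⊕ 0𝕚)))
    start = solve-∀ ring𝕚
  total-runs x (suc r) = begin
    total (nonascents x) (map (suc x ∷_) (runs (suc x) r) ++ firsts x r)
      ≡⟨ total-++ (nonascents x) (map (suc x ∷_) (runs (suc x) r)) (firsts x r) ⟩
    total (nonascents x) (map (suc x ∷_) (runs (suc x) r)) ⊕ total (nonascents x) (firsts x r)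
      ≡⟨ cong₂ _⊕_ (trans (total-≡ x (runs (suc x) r)) (total-runs (suc x) r)) (total-firsts x r x ℕ.≤-refl) ⟩
    w ⊕ w ⊗ (w ⊗ (ΣG (suc x) r ⊕ ⊝ (G (suc x) r ⊕ ofℚ (ι r)))) ⊕ w ⊗ (w ⊗ (G (suc x) r ⊕ ⊝ 1𝕚))
      ≡⟨ rearrange w (ΣG (suc x) r) (G (suc x) r) (ofℚ (ι r)) (G x (suc r)) ⟩
    w ⊕ w ⊗ (w ⊗ (ΣG x (suc r) ⊕ ⊝ (G x (suc r) ⊕ ofℚ (ι (suc r))))) ∎
    where
    open ≡-Reasoning
    rearrange : ∀ w a b c d → w ⊕ w ⊗ (w ⊗ (a ⊕ ⊝ (b ⊕ c))) ⊕ w ⊗ (w ⊗ (b ⊕ ⊝ 1𝕚)) ≡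
                              w ⊕ w ⊗ (w ⊗ (d ⊕ a ⊕ ⊝ (d ⊕ (1𝕚 ⊕ c))))
    rearrange = solve-∀ ring𝕚

  total-peak : ∀ m → total peak (abelianSeqs m) ≡ w ⊗ P m w
  total-peak m = begin
    total peak (abelianSeqs m)
      ≡⟨ total-↭ peak (abelianSeqs-↭ m) ⟩
    total peak (map (0 ∷_) (runs 0 m))
      ≡⟨ trans (total-map peak (0 ∷_) (runs 0 m)) (total-cong (runs 0 m) λ {v} → peak≡nonascents v) ⟩
    total (nonascents 0) (runs 0 m)
      ≡⟨ total-runs 0 m ⟩
    w ⊕ w ⊗ (w ⊗ (ΣG 0 m ⊕ ⊝ (0𝕚 ⊕ ofℚ (ι m))))
      ≡⟨ factor-out w (ΣG 0 m) (ofℚ (ι m)) ⟩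
    w ⊗ (1𝕚 ⊕ w ⊗ ΣG 0 m ⊕ ⊝ ofℚ (ι m) ⊗ w)
      ≡⟨ cong (λ a → w ⊗ (a ⊕ ⊝ ofℚ (ι m) ⊗ w)) (E≡ m) ⟨
    w ⊗ P m w ∎
    where
    open ≡-Reasoning
    factor-out : ∀ w a b → w ⊕ w ⊗ (w ⊗ (a ⊕ ⊝ (0𝕚 ⊕ b))) ≡ w ⊗ (1𝕚 ⊕ w ⊗ a ⊕ ⊝ b ⊗ w)
    factor-out = solve-∀ ring𝕚

-- Real operations act termwise on sequences, so passing to the `n`-th approximation commutes with
-- them by computation, and identities over `ℚ[i]` apply at every index.
at : ℕ → ℂ → ℚ[i]
at n z = seq (re z) n ,i seq (im z) n

module Evaluation (n : ℕ) (z : ℂ) where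
  open Sums (at n z)

  value : Poly → ℚ[i]
  value p = at n (eval p z)

  value-+ : ∀ p q → value (p +ₚ q) ≡ value p ⊕ value q
  value-+ []      q       = zeroˡ (value q)
    where
    zeroˡ : ∀ a → a ≡ 0𝕚 ⊕ a
    zeroˡ = solve-∀ ring𝕚
  value-+ (c ∷ p) []      = zeroʳ (value (c ∷ p))
    where
    zeroʳ : ∀ a → a ≡ a ⊕ 0𝕚
    zeroʳ = solve-∀ ring𝕚
  value-+ (c ∷ p) (d ∷ q) = trans (cong (λ v → ofℚ (seq c n) ⊕ ofℚ (seq d n) ⊕ at n z ⊗ v) (value-+ p q))
    (collect (ofℚ (seq c n)) (ofℚ (seq d n)) (at n z) (value p) (value q))
    where
    collect : ∀ c d w a b → c ⊕ d ⊕ w ⊗ (a ⊕ b) ≡ c ⊕ w ⊗ a ⊕ (d ⊕ w ⊗ b)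
    collect = solve-∀ ring𝕚

  value-t^ : ∀ k → value (t^ k) ≡ at n z ^𝕚 k
  value-t^ zero    = absorb (at n z)
    where
    absorb : ∀ w → 1𝕚 ⊕ w ⊗ 0𝕚 ≡ 1𝕚
    absorb = solve-∀ ring𝕚
  value-t^ (suc k) = trans (cong (λ v → 0𝕚 ⊕ at n z ⊗ v) (value-t^ k)) (zeroˡ (at n z ⊗ at n z ^𝕚 k))
    where
    zeroˡ : ∀ a → 0𝕚 ⊕ a ≡ a
    zeroˡ = solve-∀ ring𝕚

  value-sum : ∀ {A : Set} (f : A → ℕ) xs → value (sumₚ (map (λ a → t^ f a) xs)) ≡ total f xs
  value-sum f []       = refl
  value-sum f (x ∷ xs) = trans (value-+ (t^ f x) (sumₚ (map (λ a → t^ f a) xs))) (cong₂ _⊕_ (value-t^ (f x)) (value-sum f xs))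

  value-Peakᶜ : ∀ m → value (Peakᶜ (suc m)) ≡ at n z ⊗ P m (at n z)
  value-Peakᶜ m = trans (value-sum peak (abelianSeqs m)) (total-peak m)

-- Real-rootedness

≈0-* : ∀ x y → x ≈ 0ℝ → x ℝ.* y ≈ 0ℝ
≈0-* x y (mk≈ x→0) = mk≈ λ e 0<e →
  let B , 0<B , M , y<B = bounded {seq y} (cauchy y)
      d , 0<d , Bd      = divide B (½ * e) 0<B (halve e 0<e)
      N , x<d           = x→0 d 0<d
  in M ℕ.⊔ N , λ n le → ℚ.≤-<-trans
       (ℚ.≤-trans (ℚ.≤-reflexive (cong ∣_∣ (rearrange (seq x n) (seq y n))))
                  (*-bound (seq y n) (seq x n - 0ℚ) 0<B (y<B n (ℕ.m⊔n≤o⇒m≤o M N le)) (x<d n (ℕ.m⊔n≤o⇒n≤o M N le))))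
       (subst (_< e) (sym Bd) (½e<e e 0<e))
  where
  rearrange : ∀ a b → a * b - 0ℚ ≡ b * (a - 0ℚ)
  rearrange = solve-∀ ringℚ

≈0-+ : ∀ x y → x ≈ 0ℝ → y ≈ 0ℝ → x ℝ.+ y ≈ 0ℝ
≈0-+ x y (mk≈ x→0) (mk≈ y→0) = mk≈ λ e 0<e →
  let M , x<½e = x→0 (½ * e) (halve e 0<e)
      N , y<½e = y→0 (½ * e) (halve e 0<e)
  in M ℕ.⊔ N , λ n le → ℚ.≤-<-trans
       (ℚ.≤-trans (ℚ.≤-reflexive (cong ∣_∣ (rearrange (seq x n) (seq y n))))
                  (ℚ.∣p+q∣≤∣p∣+∣q∣ (seq x n - 0ℚ) (seq y n - 0ℚ)))
       (subst (∣ seq x n - 0ℚ ∣ + ∣ seq y n - 0ℚ ∣ <_) (halves e)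
         (ℚ.+-mono-< (x<½e n (ℕ.m⊔n≤o⇒m≤o M N le)) (y<½e n (ℕ.m⊔n≤o⇒n≤o M N le))))
  where
  rearrange : ∀ a b → a + b - 0ℚ ≡ (a - 0ℚ) + (b - 0ℚ)
  rearrange = solve-∀ ringℚ

-- A root is taken without extracting it: at an index where `|x| ≥ e`, the bound would give
-- `y ≥ c (e²)ᵏ`.
even-power-≈0 : ∀ c k x y → 0ℚ < c → (∀ n → c * (seq x n * seq x n) ^ k ≤ seq y n) → y ≈ 0ℝ → x ≈ 0ℝ
even-power-≈0 c k x y 0<c c≤y (mk≈ y→0) = mk≈ λ e 0<e →
  let N , y<ce = y→0 (c * (e * e) ^ k) (0<* 0<c (^-pos k (0<* 0<e 0<e)))
  in N , λ n le → small e 0<e n (y<ce n le)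
  where
  minus0 : ∀ a → a - 0ℚ ≡ a
  minus0 = solve-∀ ringℚ
  small : ∀ e → 0ℚ < e → ∀ n → ∣ seq y n - 0ℚ ∣ < c * (e * e) ^ k → ∣ seq x n - 0ℚ ∣ < e
  small e 0<e n y<ce rewrite minus0 (seq x n) | minus0 (seq y n) =
    ℚ.≰⇒> λ e≤x → ℚ.<-irrefl refl (ℚ.≤-<-trans
      (ℚ.≤-trans (*-mono (ℚ.<⇒≤ 0<c) ℚ.≤-refl (^-nonNeg k (0≤a² e))
                   (^-mono k (0≤a² e) (ℚ.≤-trans (*-mono (ℚ.<⇒≤ 0<e) e≤x (ℚ.<⇒≤ 0<e) e≤x) (ℚ.≤-reflexive ∣x∣²))))
                 (c≤y n))
      (subst (_< c * (e * e) ^ k) (ℚ.0≤p⇒∣p∣≡p (ℚ.≤-trans (0≤* (ℚ.<⇒≤ 0<c) (^-nonNeg k (0≤a² (seq x n)))) (c≤y n))) y<ce))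
    where
    ∣x∣² : ∣ seq x n ∣ * ∣ seq x n ∣ ≡ seq x n * seq x n
    ∣x∣² = trans (sym (ℚ.∣p*q∣≡∣p∣*∣q∣ (seq x n) (seq x n))) (ℚ.0≤p⇒∣p∣≡p (0≤a² (seq x n)))

module _ (node : ℕ → ℚ) where
  open Nodes node

  -- The node product as a complex number: being Cauchy, it is bounded, so that its product with a
  -- null sequence is null.
  ∏ℂ : ℕ → ℂ → ℂ
  ∏ℂ zero    z = ofℝ 1ℝ
  ∏ℂ (suc k) z = (z +ℂ ofℝ (fromℚ (- node k))) *ℂ ∏ℂ k z

  at-∏ℂ : ∀ n k z → at n (∏ℂ k z) ≡ ∏ k (at n z)
  at-∏ℂ n zero    z = refl
  at-∏ℂ n (suc k) z = cong ((at n z ⊕ ofℚ (- node k)) ⊗_) (at-∏ℂ n k z)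

-- For `w = a + i y` the right side is `- y · Im (Q · conj V) = y² |w|² S`, and `|w|² ≥ y²`. The
-- factor `w` in `V` matches the factor `t` of the peak polynomial.
pairing-bound : ∀ {a y p q g h S c l} → 0ℚ ≤ c * l → p * - h + q * g ≡ - (y * S) → c * l ≤ S →
  let Q = (a ,i y) ⊗ (p ,i q) ; V = (a ,i y) ⊗ (g ,i h) in
  c * (y * y * (y * y * l)) ≤ Re Q * (y * Im V) + Im Q * - (y * Re V)
pairing-bound {a} {y} {p} {q} {g} {h} {S} {c} {l} 0≤cl im-ratio cl≤S = ≤-by
  (0≤+ (0≤* (0≤* (0≤a² y) (0≤+ (0≤a² a) (0≤a² y))) (≤⇒0≤ cl≤S)) (0≤* (0≤* (0≤a² y) (0≤a² a)) 0≤cl))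
  (trans (expand a y p q g h) (trans (cong (λ t → - (y * ((a * a + y * y) * t))) im-ratio) (cert a y S c l)))
  where
  expand : ∀ a y p q g h →
    (a * p - y * q) * (y * (a * h + y * g)) + (a * q + y * p) * - (y * (a * g - y * h)) ≡
    - (y * ((a * a + y * y) * (p * - h + q * g)))
  expand = solve-∀ ringℚ
  cert : ∀ a y S c l → - (y * ((a * a + y * y) * - (y * S))) ≡
    c * (y * y * (y * y * l)) + (y * y * (a * a + y * y) * (S - c * l) + y * y * (a * a) * (c * l))
  cert = solve-∀ ringℚ

peak-roots : ∀ m z → eval (Peakᶜ (suc m)) z ≈ℂ ofℝ 0ℝ → im z ≈ 0ℝ
peak-roots m z (re≈0 , im≈0) = even-power-≈0 c (suc (suc d)) (im z)
    (re Q ℝ.* A ℝ.+ im Q ℝ.* B) 0<c bound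
    (≈0-+ (re Q ℝ.* A) (im Q ℝ.* B) (≈0-* (re Q) A re≈0) (≈0-* (im Q) B im≈0))
  where
  open Alternating (P-alternating m)
  open Nodes node
  Q = eval (Peakᶜ (suc m)) z
  V = z *ℂ ∏ℂ node (suc d) z
  A = im z ℝ.* im V
  B = ℝ.- (im z ℝ.* re V)
  result = alternating (suc d) (P m) degree decreasing alternates
  S = proj₁ result
  c = proj₁ (proj₂ (proj₂ result))
  0<c = proj₁ (proj₂ (proj₂ (proj₂ result)))
  bound : ∀ n → c * (seq (im z) n * seq (im z) n) ^ suc (suc d) ≤ seq (re Q ℝ.* A ℝ.+ im Q ℝ.* B) n
  bound n = subst₂ (λ u v → c * (y * y * (y * y * (y * y) ^ d)) ≤ Re u * (y * Im v) + Im u * - (y * Re v))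
    (sym (Evaluation.value-Peakᶜ n z m)) (sym (cong (at n z ⊗_) (at-∏ℂ node n (suc d) z)))
    (pairing-bound {seq (re z) n} {y} {Re (P m w)} {Im (P m w)} {Re (∏ (suc d) w)} {Im (∏ (suc d) w)} {S w} {c} {(y * y) ^ d}
      (0≤* (ℚ.<⇒≤ 0<c) (^-nonNeg d (0≤a² y))) (proj₁ (proj₂ result) w) (proj₂ (proj₂ (proj₂ (proj₂ result))) w))
    where
    w = at n z
    y = seq (im z) n

corollary4p11 : ∀ (n : ℕ) → RealRooted (Peakᶜ n)
corollary4p11 zero    = inj₁ All.[]
corollary4p11 (suc m) = inj₂ (peak-roots m)
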